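{- Let $p$ be a prime number and let $K$ be a mixed characteristic local field, that is, a finite field extension of the completion $\mathbb{Q}_p$ of $\mathbb{Q}$ with respect to the $p$-adic valuation. Then $K$, endowed with the unique discrete valuation extending the $p$-adic valuation on $\mathbb{Q}_p$, is a local field.
   Context: $\mathbb{Z}_{\mathrm{m}0}$ is the linearly ordered commutative group with zero obtained from the multiplicatively written ordered group $\mathbb{Z}$ (elements $\mathrm{of\_add}(n)$, $n\in\mathbb{Z}$, with $\mathrm{of\_add}(a+b)=\mathrm{of\_add}(a)\,\mathrm{of\_add}(b)$, ordered as $\mathbb{Z}$) by adjoining an absorbing smallest element $0$. A valuation on a field $F$ is a function $v: F\to \mathbb{Z}_{\mathrm{m}0}$ with $v(0)=0$, $v(1)=1$, $v(xy)=v(x)v(y)$ and $v(x+y)\le\max\{v(x),v(y)\}$; it is discrete if it is surjective. Its unit ball is $F^\circ=\{x: v(x)\le1\}$, a discrete valuation ring when $v$ is discrete, and the residue field of $F$ is $F^\circ/\mathfrak{m}_{F^\circ}$ with $\mathfrak{m}_{F^\circ}$ the maximal ideal. A local field is a field complete with respect to a discrete valuation (for the uniform structure induced by the valuation) and with finite residue field. The $p$-adic valuation on $\mathbb{Q}$ sends $0$ to $0$ and $r/s$ (nonzero integers $r,s$) to $\mathrm{of\_add}(-(a_p(r)-a_p(s)))$, where $a_p(r)$ is the exponent of $p$ in $r$; it extends by continuity to $\mathbb{Q}_p$. If $F$ is complete with respect to a discrete valuation $v$ and $K/F$ is finite, there is a unique discrete valuation $w$ on $K$ extending $v$, in the sense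 that $w|_F=v^e$ for some integer $e\ge1$. -}

module Defs where

open import Algebra.Apartness.Bundles using (HeytingField)
open import Algebra.Bundles using (CommutativeRing)
import Algebra.Definitions as Definitions
import Algebra.Definitions.RawMonoid as RawMonoidDefinitions
open import Algebra.Morphism.Structures using (module RingMorphisms)
import Algebra.Properties.Ring as RingProperties
open import Data.Empty using (⊥-elim)
open import Data.Integer.Base as ℤ using (ℤ; 0ℤ)
import Data.Integer.Properties as ℤ
open import Data.List.Base using (List)
import Data.List.Relation.Unary.Enumerates.Setoid as Enumerates
open import Data.Nat.Base as ℕ using (ℕ; zero; suc; _≥_)
open import Data.Nat.Divisibility using (_∣?_)
open import Data.Product.Base using (Σ; ∃; ∃-syntax; _×_; _,_; proj₁; proj₂)
open import Data.Rational.Base as ℚ using (ℚ; mkℚ)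
import Data.Rational.Properties as ℚ
open import Data.Sum.Base using (inj₁; inj₂)
open import Data.Vec.Functional using (Vector)
open import Function.Definitions using (Surjective)
open import Level using (Level; _⊔_; 0ℓ) renaming (suc to lsuc)
open import Relation.Binary.Definitions using (Decidable)
open import Relation.Binary.PropositionalEquality
  using (_≡_; refl; sym; trans; cong; subst)
import Relation.Binary.Reasoning.Setoid as SetoidReasoning
open import Relation.Nullary using (¬_; yes; no)
open import Relation.Nullary.Construct.Add.Infimum using (_₋; ⊥₋; [_])
open import Relation.Nullary.Decidable using (¬?)
open import Relation.Binary.Construct.Add.Infimum.NonStrict ℤ._≤_
  using (_≤₋_; [_]; ⊥₋≤_; ≤₋-trans; ≤₋-reflexive-≡)
open import Relation.Binary.Construct.Add.Infimum.Strict ℤ._<_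
  using (_<₋_; [_]; ⊥₋<[_])

private
  variable
    c ℓ₁ ℓ₂ c′ ℓ₁′ ℓ₂′ : Level

-- The value group with zero: ⊥₋ is 0 and [ n ] is of_add(n).

ℤₘ₀ : Set
ℤₘ₀ = ℤ ₋

infix  4 _≤ᵛ_ _<ᵛ_
infixl 6 _⊔ᵛ_
infixl 7 _*ᵛ_
infixr 8 _^ᵛ_

_≤ᵛ_ _<ᵛ_ : ℤₘ₀ → ℤₘ₀ → Set
_≤ᵛ_ = _≤₋_
_<ᵛ_ = _<₋_

1ᵛ : ℤₘ₀
1ᵛ = [ 0ℤ ]

_*ᵛ_ : ℤₘ₀ → ℤₘ₀ → ℤₘ₀
⊥₋    *ᵛ _     = ⊥₋
[ _ ] *ᵛ ⊥₋    = ⊥₋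
[ x ] *ᵛ [ y ] = [ x ℤ.+ y ]

_⊔ᵛ_ : ℤₘ₀ → ℤₘ₀ → ℤₘ₀
⊥₋    ⊔ᵛ y     = y
[ x ] ⊔ᵛ ⊥₋    = [ x ]
[ x ] ⊔ᵛ [ y ] = [ x ℤ.⊔ y ]

_^ᵛ_ : ℤₘ₀ → ℕ → ℤₘ₀
x ^ᵛ zero  = 1ᵛ
x ^ᵛ suc n = x *ᵛ x ^ᵛ n

≤ᵛ-trans : ∀ {x y z} → x ≤ᵛ y → y ≤ᵛ z → x ≤ᵛ z
≤ᵛ-trans = ≤₋-trans ℤ.≤-trans

≤ᵛ-reflexive : ∀ {x y} → x ≡ y → x ≤ᵛ y
≤ᵛ-reflexive = ≤₋-reflexive-≡ ℤ.≤-reflexive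

≤-<ᵛ-trans : ∀ {x y z} → x ≤ᵛ y → y <ᵛ z → x <ᵛ z
≤-<ᵛ-trans (⊥₋≤ _) ⊥₋<[ _ ] = ⊥₋<[ _ ]
≤-<ᵛ-trans (⊥₋≤ _) [ _ ]    = ⊥₋<[ _ ]
≤-<ᵛ-trans [ p ]   [ q ]    = [ ℤ.≤-<-trans p q ]

<ᵛ⇒≱ᵛ : ∀ {x y} → x <ᵛ y → ¬ (y ≤ᵛ x)
<ᵛ⇒≱ᵛ [ p ] [ q ] = ℤ.<⇒≱ p q

⊔ᵛ-lub : ∀ {x y z} → x ≤ᵛ z → y ≤ᵛ z → x ⊔ᵛ y ≤ᵛ z
⊔ᵛ-lub (⊥₋≤ _) q       = q
⊔ᵛ-lub [ p ]   (⊥₋≤ _) = [ p ]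
⊔ᵛ-lub [ p ]   [ q ]   = [ ℤ.⊔-lub p q ]

⊔ᵛ-lub-< : ∀ {x y z} → x <ᵛ z → y <ᵛ z → x ⊔ᵛ y <ᵛ z
⊔ᵛ-lub-< ⊥₋<[ _ ] q        = q
⊔ᵛ-lub-< [ p ]    ⊥₋<[ _ ] = [ p ]
⊔ᵛ-lub-< {[ x ]} {[ y ]} [ p ] [ q ] with ℤ.⊔-sel x y
... | inj₁ e = [ subst (ℤ._< _) (sym e) p ]
... | inj₂ e = [ subst (ℤ._< _) (sym e) q ]

*ᵛ-mono-≤1 : ∀ {x y} → x ≤ᵛ 1ᵛ → y ≤ᵛ 1ᵛ → x *ᵛ y ≤ᵛ 1ᵛ
*ᵛ-mono-≤1 (⊥₋≤ _) _       = ⊥₋≤ _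
*ᵛ-mono-≤1 [ _ ]   (⊥₋≤ _) = ⊥₋≤ _
*ᵛ-mono-≤1 [ p ]   [ q ]   = [ ℤ.+-mono-≤ p q ]

*ᵛ-mono-<1 : ∀ {x y} → x ≤ᵛ 1ᵛ → y <ᵛ 1ᵛ → x *ᵛ y <ᵛ 1ᵛ
*ᵛ-mono-<1 (⊥₋≤ _) _        = ⊥₋<[ _ ]
*ᵛ-mono-<1 [ _ ]   ⊥₋<[ _ ] = ⊥₋<[ _ ]
*ᵛ-mono-<1 [ p ]   [ q ]    = [ ℤ.+-mono-≤-< p q ]

-- A Heyting field in which x # y is decidable: every element is zero or
-- invertible, and never both.  Classically this is just a field, _#_
-- being the negation of _≈_.
record Field c ℓ₁ ℓ₂ : Set (lsuc (c ⊔ ℓ₁ ⊔ ℓ₂)) where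
  field
    heytingField : HeytingField c ℓ₁ ℓ₂

  open HeytingField heytingField public

  field
    _#?_ : Decidable _#_

  commutativeRing : CommutativeRing c ℓ₁
  commutativeRing = record { isCommutativeRing = isCommutativeRing }

  open CommutativeRing commutativeRing public
    using (ring; rawRing; +-rawMonoid)

-- Ring homomorphisms between fields are automatically injective.
IsFieldEmbedding : (F : Field c ℓ₁ ℓ₂) (K : Field c′ ℓ₁′ ℓ₂′) →
  (Field.Carrier F → Field.Carrier K) → Set (c ⊔ ℓ₁ ⊔ ℓ₁′)
IsFieldEmbedding F K =
  RingMorphisms.IsRingHomomorphism (Field.rawRing F) (Field.rawRing K)

-- A field extension K/F of finite degree: K has a finite basis
-- e₀, …, eₙ₋₁ as an F-vector space, F acting through ι.
record FiniteExtension (F : Field c ℓ₁ ℓ₂) (K : Field c′ ℓ₁′ ℓ₂′) :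
       Set (c ⊔ ℓ₁ ⊔ c′ ⊔ ℓ₁′) where
  private
    module F = Field F
    module K = Field K
  field
    ι           : F.Carrier → K.Carrier
    isEmbedding : IsFieldEmbedding F K ι
    degree      : ℕ
    basis       : Vector K.Carrier degree

  combination : Vector F.Carrier degree → K.Carrier
  combination x = RawMonoidDefinitions.sum K.+-rawMonoid λ i → ι (x i) K.* basis i

  field
    spanning    : ∀ y → ∃[ x ] combination x K.≈ y
    independent : ∀ x → combination x K.≈ K.0# → ∀ i → x i F.≈ F.0#

record Valuation (F : Field c ℓ₁ ℓ₂) : Set (c ⊔ ℓ₁) where
  open Field F hiding (refl; sym; trans)
  field
    val         : Carrier → ℤₘ₀
    val-cong    : ∀ {x y} → x ≈ y → val x ≡ val y
    val-0       : val 0# ≡ ⊥₋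
    val-1       : val 1# ≡ 1ᵛ
    val-*       : ∀ x y → val (x * y) ≡ val x *ᵛ val y
    ultrametric : ∀ x y → val (x + y) ≤ᵛ val x ⊔ᵛ val y

  val-neg : ∀ x → val (- x) ≡ val x
  val-neg x = trans (val-cong (Field.sym F (RP.-1*x≈-x x)))
                    (trans (val-* (- 1#) x) (unit (val (- 1#)) -1-square (val x)))
    where
    module RP = RingProperties ring
    -1-square : val (- 1#) *ᵛ val (- 1#) ≡ 1ᵛ
    -1-square = trans (sym (val-* (- 1#) (- 1#)))
      (trans (val-cong (Field.trans F (RP.-1*x≈-x (- 1#)) (RP.-‿involutive 1#))) val-1)

    double≡0 : ∀ z → z ℤ.+ z ≡ 0ℤ → z ≡ 0ℤ
    double≡0 (ℤ.+ zero) _ = refl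

    just-inj : ∀ {i j : ℤ} → _≡_ {A = ℤₘ₀} [ i ] [ j ] → i ≡ j
    just-inj refl = refl

    unit : ∀ u → u *ᵛ u ≡ 1ᵛ → ∀ y → u *ᵛ y ≡ y
    unit [ z ] e ⊥₋    = refl
    unit [ z ] e [ y ] rewrite double≡0 z (just-inj e) = cong [_] (ℤ.+-identityˡ y)

  ultrametric-‿ : ∀ x y → val (x - y) ≤ᵛ val x ⊔ᵛ val y
  ultrametric-‿ x y = subst (λ t → val (x - y) ≤ᵛ val x ⊔ᵛ t) (val-neg y) (ultrametric x (- y))

  IsDiscrete : Set (c ⊔ ℓ₁)
  IsDiscrete = Surjective _≈_ _≡_ val

-- The uniform structure induced by v has the countable base of entourages
-- { (x , y) | v (x - y) < of_add(n) }, n ∈ ℤ; completeness for it is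
-- convergence of Cauchy sequences.
module _ {F : Field c ℓ₁ ℓ₂} (v : Valuation F) where
  open Field F hiding (refl; sym; trans)
  open Valuation v

  Cauchy : (ℕ → Carrier) → Set
  Cauchy s = ∀ (n : ℤ) → ∃[ N ] ∀ {i j} → i ≥ N → j ≥ N → val (s i - s j) <ᵛ [ n ]

  _ConvergesTo_ : (ℕ → Carrier) → Carrier → Set
  s ConvergesTo x = ∀ (n : ℤ) → ∃[ N ] ∀ {i} → i ≥ N → val (s i - x) <ᵛ [ n ]

  IsComplete : Set c
  IsComplete = ∀ s → Cauchy s → ∃[ x ] s ConvergesTo x

  unitBall : CommutativeRing c ℓ₁
  unitBall = record
    { Carrier = Σ Carrier λ x → val x ≤ᵛ 1ᵛ
    ; _≈_ = λ x y → proj₁ x ≈ proj₁ y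
    ; _+_ = λ (x , p) (y , q) → x + y , ≤ᵛ-trans (ultrametric x y) (⊔ᵛ-lub p q)
    ; _*_ = λ (x , p) (y , q) →
        x * y , ≤ᵛ-trans (≤ᵛ-reflexive (val-* x y)) (*ᵛ-mono-≤1 p q)
    ; -_ = λ (x , p) → - x , ≤ᵛ-trans (≤ᵛ-reflexive (val-neg x)) p
    ; 0# = 0# , ≤ᵛ-trans (≤ᵛ-reflexive val-0) (⊥₋≤ 1ᵛ)
    ; 1# = 1# , ≤ᵛ-reflexive val-1
    ; isCommutativeRing = record
      { isRing = record
        { +-isAbelianGroup = record
          { isGroup = record
            { isMonoid = record
              { isSemigroup = record
                { isMagma = record
                  { isEquivalence = record
                    { refl  = Field.refl F
                    ; sym   = Field.sym F
                    ; trans = Field.trans F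
                    }
                  ; ∙-cong = +-cong
                  }
                ; assoc = λ x y z → +-assoc _ _ _
                }
              ; identity = (λ x → +-identityˡ _) , (λ x → +-identityʳ _)
              }
            ; inverse = (λ x → -‿inverseˡ _) , (λ x → -‿inverseʳ _)
            ; ⁻¹-cong = -‿cong
            }
          ; comm = λ x y → +-comm _ _
          }
        ; *-cong = *-cong
        ; *-assoc = λ x y z → *-assoc _ _ _
        ; *-identity = (λ x → *-identityˡ _) , (λ x → *-identityʳ _)
        ; distrib = (λ x y z → distribˡ _ _ _) , (λ x y z → distribʳ _ _ _)
        }
      ; *-comm = λ x y → *-comm _ _
      }
    }

  private module O = CommutativeRing unitBall

  -- The maximal ideal of the local ring F°: its non-invertible elements.
  MaximalIdeal : O.Carrier → Set (c ⊔ ℓ₁)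
  MaximalIdeal x = ¬ Definitions.Invertible O._≈_ O.1# O._*_ x

  ∈MaximalIdeal⇒val<1 : ∀ x → MaximalIdeal x → val (proj₁ x) <ᵛ 1ᵛ
  ∈MaximalIdeal⇒val<1 (x , p) x∈m = go (val x) refl p
    where
    go : ∀ γ → val x ≡ γ → γ ≤ᵛ 1ᵛ → val x <ᵛ 1ᵛ
    go ⊥₋    eq _ = subst (_<ᵛ 1ᵛ) (sym eq) ⊥₋<[ _ ]
    go [ z ] eq [ z≤0 ] with z ℤ.<? 0ℤ
    ... | yes z<0 = subst (_<ᵛ 1ᵛ) (sym eq) [ z<0 ]
    ... | no z≮0 with ℤ.≤-antisym z≤0 (ℤ.≮⇒≥ z≮0) | x #? 0#
    ...   | refl | no ¬x#0 = absurd (trans (sym eq) (trans (val-cong (proj₁ (tight x 0#) ¬x#0)) val-0))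
      where
      absurd : [ 0ℤ ] ≡ ⊥₋ → val x <ᵛ 1ᵛ
      absurd ()
    ...   | refl | yes x#0 = ⊥-elim (x∈m ((y , vy≤1) , yx≈1 , Field.trans F (*-comm x y) yx≈1))
      where
      y = proj₁ (#⇒invertible x#0)
      x-0≈x : x - 0# ≈ x
      x-0≈x = Field.trans F (+-congˡ (RingProperties.-0#≈0# ring)) (+-identityʳ x)
      yx≈1 : y * x ≈ 1#
      yx≈1 = Field.trans F (*-congˡ (Field.sym F x-0≈x)) (proj₁ (proj₂ (#⇒invertible x#0)))
      cancel : ∀ γ → γ *ᵛ 1ᵛ ≡ 1ᵛ → γ ≤ᵛ 1ᵛ
      cancel [ k ] e = ≤ᵛ-reflexive (trans (cong [_] (sym (ℤ.+-identityʳ k))) e)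
      vy≤1 : val y ≤ᵛ 1ᵛ
      vy≤1 = cancel (val y)
        (trans (cong (val y *ᵛ_) (sym eq)) (trans (sym (val-* y x)) (trans (val-cong yx≈1) val-1)))

  val<1⇒∈MaximalIdeal : ∀ x → val (proj₁ x) <ᵛ 1ᵛ → MaximalIdeal x
  val<1⇒∈MaximalIdeal (x , p) vx<1 ((y , q) , yx≈1 , _) =
    <ᵛ⇒≱ᵛ (*ᵛ-mono-<1 q vx<1)
      (≤ᵛ-reflexive (sym (trans (sym (val-* y x)) (trans (val-cong yx≈1) val-1))))

  -- F° / 𝔪: the elements of F°, identified when they differ by an
  -- element of 𝔪.
  residueField : CommutativeRing c (c ⊔ ℓ₁)
  residueField = record
    { Carrier = O.Carrier
    ; _≈_ = _~_
    ; _+_ = O._+_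
    ; _*_ = O._*_
    ; -_ = O.-_
    ; 0# = O.0#
    ; 1# = O.1#
    ; isCommutativeRing = record
      { isRing = record
        { +-isAbelianGroup = record
          { isGroup = record
            { isMonoid = record
              { isSemigroup = record
                { isMagma = record
                  { isEquivalence = record
                    { refl  = λ {x} → ≈⇒~ {x} {x} (O.refl {x})
                    ; sym   = λ {x} {y} → ~-sym {x} {y}
                    ; trans = λ {x} {y} {z} → ~-trans {x} {y} {z}
                    }
                  ; ∙-cong = λ {x} {y} {u} {v} → ~-+-cong {x} {y} {u} {v}
                  }
                ; assoc = λ x y z → ≈⇒~ {(x O.+ y) O.+ z} {x O.+ (y O.+ z)} (O.+-assoc x y z)
                }
              ; identity = (λ x → ≈⇒~ {O.0# O.+ x} {x} (O.+-identityˡ x))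
                         , (λ x → ≈⇒~ {x O.+ O.0#} {x} (O.+-identityʳ x))
              }
            ; inverse = (λ x → ≈⇒~ {(O.- x) O.+ x} {O.0#} (O.-‿inverseˡ x))
                      , (λ x → ≈⇒~ {x O.+ (O.- x)} {O.0#} (O.-‿inverseʳ x))
            ; ⁻¹-cong = λ {x} {y} → ~-neg-cong {x} {y}
            }
          ; comm = λ x y → ≈⇒~ {x O.+ y} {y O.+ x} (O.+-comm x y)
          }
        ; *-cong = λ {x} {y} {u} {v} → ~-*-cong {x} {y} {u} {v}
        ; *-assoc = λ x y z → ≈⇒~ {(x O.* y) O.* z} {x O.* (y O.* z)} (O.*-assoc x y z)
        ; *-identity = (λ x → ≈⇒~ {O.1# O.* x} {x} (O.*-identityˡ x))
                     , (λ x → ≈⇒~ {x O.* O.1#} {x} (O.*-identityʳ x))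
        ; distrib = (λ x y z → ≈⇒~ {x O.* (y O.+ z)} {x O.* y O.+ x O.* z} (O.distribˡ x y z))
                  , (λ x y z → ≈⇒~ {(y O.+ z) O.* x} {y O.* x O.+ z O.* x} (O.distribʳ x y z))
        }
      ; *-comm = λ x y → ≈⇒~ {x O.* y} {y O.* x} (O.*-comm x y)
      }
    }
    where
    module RP = RingProperties ring

    infix 4 _~_
    _~_ : O.Carrier → O.Carrier → Set (c ⊔ ℓ₁)
    x ~ y = MaximalIdeal (x O.- y)

    small : ∀ x y → x ~ y → val (proj₁ x - proj₁ y) <ᵛ 1ᵛ
    small x y = ∈MaximalIdeal⇒val<1 (x O.- y)

    bySmall : ∀ x y d → val d <ᵛ 1ᵛ → d ≈ proj₁ x - proj₁ y → x ~ y
    bySmall x y d d<1 e =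
      val<1⇒∈MaximalIdeal (x O.- y) (subst (_<ᵛ 1ᵛ) (val-cong e) d<1)

    sum< : ∀ {d e} → val d <ᵛ 1ᵛ → val e <ᵛ 1ᵛ → val (d + e) <ᵛ 1ᵛ
    sum< {d} {e} p q = ≤-<ᵛ-trans (ultrametric d e) (⊔ᵛ-lub-< p q)

    neg< : ∀ {d} → val d <ᵛ 1ᵛ → val (- d) <ᵛ 1ᵛ
    neg< {d} = subst (_<ᵛ 1ᵛ) (sym (val-neg d))

    mul< : ∀ (x : O.Carrier) {d} → val d <ᵛ 1ᵛ → val (proj₁ x * d) <ᵛ 1ᵛ
    mul< (x , p) q = subst (_<ᵛ 1ᵛ) (sym (val-* x _)) (*ᵛ-mono-<1 p q)

    telescope : ∀ x y z → (x - y) + (y - z) ≈ x - z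
    telescope x y z = R.begin
      (x - y) + (y - z)     R.≈⟨ +-assoc x (- y) (y - z) ⟩
      x + (- y + (y - z))   R.≈⟨ +-congˡ (+-assoc (- y) y (- z)) ⟨
      x + ((- y + y) - z)   R.≈⟨ +-congˡ (+-congʳ (-‿inverseˡ y)) ⟩
      x + (0# - z)          R.≈⟨ +-congˡ (+-identityˡ (- z)) ⟩
      x - z                 R.∎
      where module R = SetoidReasoning setoid

    ≈⇒~ : ∀ {x y} → x O.≈ y → x ~ y
    ≈⇒~ {x} {y} e = bySmall x y 0# (subst (_<ᵛ 1ᵛ) (sym val-0) ⊥₋<[ _ ])
      (Field.trans F (Field.sym F (-‿inverseʳ (proj₁ x))) (+-congˡ (-‿cong e)))

    ~-sym : ∀ {x y} → x ~ y → y ~ x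
    ~-sym {x} {y} p = bySmall y x _ (neg< {proj₁ x - proj₁ y} (small x y p))
      (Field.trans F (RP.-‿anti-homo-+ (proj₁ x) (- proj₁ y)) (+-congʳ (RP.-‿involutive (proj₁ y))))

    ~-trans : ∀ {x y z} → x ~ y → y ~ z → x ~ z
    ~-trans {x} {y} {z} p q = bySmall x z _ (sum< (small x y p) (small y z q))
      (telescope (proj₁ x) (proj₁ y) (proj₁ z))

    ~-+-cong : ∀ {x y u v} → x ~ y → u ~ v → (x O.+ u) ~ (y O.+ v)
    ~-+-cong {x} {y} {u} {v} p q = ~-trans {x O.+ u} {y O.+ u} {y O.+ v}
      (bySmall (x O.+ u) (y O.+ u) _ (small x y p) (shift (proj₁ x) (proj₁ y) (proj₁ u)))
      (bySmall (y O.+ u) (y O.+ v) _ (small u v q)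
        (Field.trans F (shift (proj₁ u) (proj₁ v) (proj₁ y))
          (+-cong (+-comm _ _) (-‿cong (+-comm _ _)))))
      where
      shift : ∀ x y u → x - y ≈ (x + u) - (y + u)
      shift x y u = R.begin
        x - y                     R.≈⟨ telescope x (- u) y ⟨
        (x - - u) + (- u - y)     R.≈⟨ +-cong (+-congˡ (RP.-‿involutive u)) (Field.sym F (RP.-‿anti-homo-+ y u)) ⟩
        (x + u) - (y + u)         R.∎
        where module R = SetoidReasoning setoid

    ~-neg-cong : ∀ {x y} → x ~ y → (O.- x) ~ (O.- y)
    ~-neg-cong {x} {y} p = bySmall (O.- x) (O.- y) _ (neg< {proj₁ x - proj₁ y} (small x y p))
      (Field.sym F (RP.-‿+-comm (proj₁ x) (- proj₁ y)))

    ~-*-cong : ∀ {x y u v} → x ~ y → u ~ v → (x O.* u) ~ (y O.* v)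
    ~-*-cong {x} {y} {u} {v} p q = ~-trans {x O.* u} {y O.* u} {y O.* v}
      (bySmall (x O.* u) (y O.* u) _ (mul< u {proj₁ x - proj₁ y} (small x y p))
        (Field.trans F (dist (proj₁ u) (proj₁ x) (proj₁ y))
          (+-cong (*-comm _ _) (-‿cong (*-comm _ _)))))
      (bySmall (y O.* u) (y O.* v) _ (mul< y {proj₁ u - proj₁ v} (small u v q))
        (dist (proj₁ y) (proj₁ u) (proj₁ v)))
      where
      dist : ∀ a b c → a * (b - c) ≈ a * b - a * c
      dist a b c = Field.trans F (distribˡ a b (- c))
        (+-congˡ (Field.sym F (RP.-‿distribʳ-* a c)))

  HasFiniteResidueField : Set (c ⊔ ℓ₁)
  HasFiniteResidueField = ∃ (Enumerates.IsEnumeration (CommutativeRing.setoid residueField))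

record IsLocalField (F : Field c ℓ₁ ℓ₂) (v : Valuation F) : Set (c ⊔ ℓ₁) where
  field
    isDiscrete         : Valuation.IsDiscrete v
    isComplete         : IsComplete v
    finiteResidueField : HasFiniteResidueField v

-- (F̂ , v̂) is a completion of F with respect to v: a complete valued field
-- in which F embeds densely, v̂ being the extension of v by continuity.
record IsCompletion (F : Field c ℓ₁ ℓ₂) (v : Field.Carrier F → ℤₘ₀)
                    (F̂ : Field c′ ℓ₁′ ℓ₂′) (v̂ : Valuation F̂) :
                    Set (c ⊔ ℓ₁ ⊔ c′ ⊔ ℓ₁′) where
  private
    module F = Field F
    module F̂ = Field F̂
  open Valuation v̂
  field
    ι           : F.Carrier → F̂.Carrier
    isEmbedding : IsFieldEmbedding F F̂ ι
    extends     : ∀ x → val (ι x) ≡ v x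
    dense       : ∀ y (n : ℤ) → ∃[ x ] val (y F̂.- ι x) <ᵛ [ n ]
    complete    : IsComplete v̂

-- w restricts to vᵉ on F for some e ≥ 1.
Extends : {F : Field c ℓ₁ ℓ₂} {K : Field c′ ℓ₁′ ℓ₂′} →
  FiniteExtension F K → Valuation F → Valuation K → Set c
Extends K/F v w = ∃[ e ] e ≥ 1 × ∀ x →
  Valuation.val w (FiniteExtension.ι K/F x) ≡ Valuation.val v x ^ᵛ e

ℚ-field : Field 0ℓ 0ℓ 0ℓ
ℚ-field = record
  { heytingField = ℚ.heytingField
  ; _#?_ = λ x y → ¬? (x ℚ.≟ y)
  }

-- The largest k ≤ b with p ^ k ∣ r.
exponentUpTo : ℕ → ℕ → ℕ → ℕ
exponentUpTo p r zero = zero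
exponentUpTo p r (suc b) with p ℕ.^ suc b ∣? r
... | yes _ = suc b
... | no  _ = exponentUpTo p r b

-- The exponent of p in r, for p ≥ 2 and r ≥ 1: then r < p ^ r, so the
-- bound excludes nothing.
exponent : ℕ → ℕ → ℕ
exponent p r = exponentUpTo p r r

padicVal : ℕ → ℚ → ℤₘ₀
padicVal p (mkℚ (ℤ.+ zero) _   _) = ⊥₋
padicVal p (mkℚ r          s-1 _) =
  [ ℤ.- (ℤ.+ exponent p ℤ.∣ r ∣ ℤ.- ℤ.+ exponent p (suc s-1)) ]

{-# OPTIONS --safe #-}

-- Write O for the unit ball of ℚₚ.  If w x ≤ 1, scale a linear relation among
-- 1, x, x², … so that its last coefficient of maximal valuation, say at xᵐ, is 1.
-- Then xᵐ is an O-combination of lower powers up to p O[x], and by completeness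
-- (as in Weierstrass division) it is exactly such a combination.  So the
-- O-lattice generated by the products of the basis with 1, …, xᵐ⁻¹ is finitely
-- generated and x-stable, whence tr x ∈ O.  In characteristic 0 the trace form
-- is nondegenerate, because tr (y y⁻¹) is the degree, so every coordinate of x
-- is a fixed linear combination of the traces tr (eⱼ x): the coordinates are
-- bounded on the unit ball of K.  Completeness of K is then inherited
-- coordinatewise, and approximating the coordinates by p-adic expansions leaves
-- finitely many residue classes.  Every bound is computed, so no appeal to
-- compactness or to Markov's principle is made.

module Submission where

open import Defs
open import Algebra.Bundles using (CommutativeRing)
open import Algebra.Morphism.Structures using (module RingMorphisms)
import Algebra.Properties.Ring as RingProperties
import Algebra.Properties.Semiring.Exp as SemiringExp
import Algebra.Properties.Semiring.Mult as SemiringMult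
import Algebra.Properties.Semiring.Sum as SemiringSum
import Algebra.Solver.Ring as RingSolver
import Algebra.Solver.Ring.AlmostCommutativeRing as ACR
open import Data.Empty using (⊥-elim)
open import Data.Fin.Base using (Fin; zero; suc; punchIn; punchOut; toℕ; remQuot; combine)
import Data.Fin.Properties as Fin
open import Data.Integer.Base as ℤ using (ℤ; 0ℤ; +_; -[1+_])
import Data.Integer.DivMod as ℤ
import Data.Integer.Properties as ℤ
open import Data.List.Base using (List; []; _∷_; map; concatMap; cartesianProductWith; upTo)
import Data.List.Membership.Propositional.Properties as List
open import Data.List.Relation.Unary.Any as Any using (Any; here; there)
import Data.List.Relation.Unary.Any.Properties as Any
open import Data.Maybe.Base using (Maybe; just; nothing)
open import Data.Nat.Base as ℕ using (ℕ; zero; suc)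
open import Data.Nat.Coprimality as Coprimality using (Coprime; coprime-Bézout)
open import Data.Nat.Divisibility using (_∤_; divides; _∣?_; >⇒∤; ∣-reflexive)
open import Data.Nat.GCD using (module Bézout)
open import Data.Nat.Primality using (Prime; prime⇒irreducible; prime⇒nonTrivial; prime⇒nonZero)
import Data.Nat.Properties as ℕ
open import Data.Product.Base using (Σ; ∃-syntax; _×_; _,_; proj₁; proj₂; uncurry)
open import Data.Rational.Base as ℚ using (ℚ; mkℚ)
import Data.Rational.Properties as ℚ
open import Data.Rational.Unnormalised.Base using (*≡*)
import Data.Rational.Unnormalised.Properties as ℚᵘ
open import Data.Sign.Base as Sign using (Sign)
open import Data.Sum.Base using (_⊎_; inj₁; inj₂)
open import Data.Vec.Functional as Vector using (Vector; head; tail; insertAt; removeAt)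
import Data.Vec.Functional.Properties as Vector
open import Function.Base using (_∘_; const)
open import Level using (Level; _⊔_)
open import Relation.Binary.Construct.Add.Infimum.NonStrict ℤ._≤_ using ([_]; ⊥₋≤_)
open import Relation.Binary.Construct.Add.Infimum.Strict ℤ._<_ using ([_]; ⊥₋<[_])
open import Relation.Binary.PropositionalEquality using (_≡_; refl; sym; trans; cong; cong₂; subst)
import Relation.Binary.Reasoning.Setoid as SetoidReasoning
open import Relation.Nullary using (¬_; yes; no; contradiction)
open import Relation.Nullary.Construct.Add.Infimum using (⊥₋; [_])

-- Nothing is known about `w` beyond its restriction to the base, and the textbook arguments that
-- norms on a finite-dimensional space are equivalent rest on a positive distance to a closed
-- subspace, for which they give no value. The trace avoids this: it is defined algebraically, and
-- an integral matrix of multiplication by x bounds it at once. What has to be produced is such a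
-- matrix, hence an integral equation for x. The choice of the last coefficient of maximal valuation
-- is what makes this possible: every later coefficient then lies in πO, so the relation reads l +
-- xᵐ (1 + π x h) = 0 with l a combination of lower powers, as in Weierstrass preparation, and xᵐ
-- can be isolated modulo π. Iteration leaves remainders πᵏ r with r in O[x], and w x ≤ 1 is what
-- forces them to tend to zero. Each passage between K and its coordinates loses a fixed number of
-- digits: a bound for the basis, a bound for the inverse of the Gram matrix of the trace form, and
-- a factor for the exponent relating `w` to `v`. These losses are carried along explicitly.

private
  variable
    c ℓ₁ ℓ₂ c′ ℓ₁′ ℓ₂′ ℓᴬ ℓᴾ : Level
    A : Set ℓᴬ

-- A ring solver with integer coefficients

module IntegerCoefficients {c ℓ : Level} (R : CommutativeRing c ℓ) where
  open CommutativeRing R hiding (refl)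
  open RingProperties ring
  open SemiringMult semiring using (×-homo-+; ×1-homo-*) renaming (_×_ to _·_)
  private module R = CommutativeRing R
  open SetoidReasoning setoid

  -- fromℤ (+ 1) is 1# + 0# and not 1#, so 1# enters the solver calls below as a
  -- variable.
  fromℤ : ℤ → Carrier
  fromℤ (+ n)    = n · 1#
  fromℤ -[1+ n ] = - (suc n · 1#)

  fromℤ-⊖ : ∀ m n → fromℤ (m ℤ.⊖ n) ≈ m · 1# - n · 1#
  fromℤ-⊖ m zero = begin
    m · 1#          ≈⟨ +-identityʳ _ ⟨
    m · 1# + 0#     ≈⟨ +-congˡ -0#≈0# ⟨
    m · 1# - 0#     ∎
  fromℤ-⊖ zero (suc n) = R.sym (+-identityˡ _)
  fromℤ-⊖ (suc m) (suc n) = begin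
    fromℤ (suc m ℤ.⊖ suc n)                 ≡⟨ cong fromℤ (ℤ.[1+m]⊖[1+n]≡m⊖n m n) ⟩
    fromℤ (m ℤ.⊖ n)                         ≈⟨ fromℤ-⊖ m n ⟩
    m · 1# - n · 1#                         ≈⟨ +-congʳ (xyx⁻¹≈y 1# _) ⟨
    (1# + m · 1# - 1#) - n · 1#             ≈⟨ +-assoc _ _ _ ⟩
    (1# + m · 1#) + (- 1# - n · 1#)         ≈⟨ +-congˡ (-‿+-comm 1# _) ⟩
    suc m · 1# - suc n · 1#                 ∎

  fromℤ-neg : ∀ i → fromℤ (ℤ.- i) ≈ - fromℤ i
  fromℤ-neg (+ zero)  = R.sym -0#≈0#
  fromℤ-neg (+ suc n) = R.refl
  fromℤ-neg -[1+ n ]  = R.sym (-‿involutive _)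

  fromℤ-+ : ∀ i j → fromℤ (i ℤ.+ j) ≈ fromℤ i + fromℤ j
  fromℤ-+ (+ m)    (+ n)    = ×-homo-+ 1# m n
  fromℤ-+ (+ m)    -[1+ n ] = fromℤ-⊖ m (suc n)
  fromℤ-+ -[1+ m ] (+ n)    = R.trans (fromℤ-⊖ n (suc m)) (+-comm _ _)
  fromℤ-+ -[1+ m ] -[1+ n ] = begin
    - (suc (suc (m ℕ.+ n)) · 1#)      ≈⟨ -‿cong (+-congˡ (×-homo-+ 1# (suc m) n)) ⟩
    - (1# + (suc m · 1# + n · 1#))    ≈⟨ -‿cong (+-assoc 1# _ _) ⟨
    - (1# + suc m · 1# + n · 1#)      ≈⟨ -‿cong (+-congʳ (+-comm _ _)) ⟩
    - (suc m · 1# + 1# + n · 1#)      ≈⟨ -‿cong (+-assoc _ _ _) ⟩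
    - (suc m · 1# + suc n · 1#)       ≈⟨ -‿+-comm _ _ ⟨
    - (suc m · 1#) - suc n · 1#       ∎

  private
    fromℤ-*⁺ : ∀ m n → fromℤ (Sign.+ ℤ.◃ (m ℕ.* n)) ≈ (m · 1#) * (n · 1#)
    fromℤ-*⁺ m n = R.trans (R.reflexive (cong fromℤ (ℤ.+◃n≡+n (m ℕ.* n)))) (×1-homo-* m n)

    fromℤ-*⁻ : ∀ m n → fromℤ (Sign.- ℤ.◃ (m ℕ.* n)) ≈ - ((m · 1#) * (n · 1#))
    fromℤ-*⁻ m n = begin
      fromℤ (Sign.- ℤ.◃ (m ℕ.* n))     ≡⟨ cong fromℤ (ℤ.-◃n≡-n (m ℕ.* n)) ⟩
      fromℤ (ℤ.- (+ (m ℕ.* n)))        ≈⟨ fromℤ-neg (+ (m ℕ.* n)) ⟩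
      - ((m ℕ.* n) · 1#)               ≈⟨ -‿cong (×1-homo-* m n) ⟩
      - ((m · 1#) * (n · 1#))          ∎

  fromℤ-* : ∀ i j → fromℤ (i ℤ.* j) ≈ fromℤ i * fromℤ j
  fromℤ-* (+ m)    (+ n)    = fromℤ-*⁺ m n
  fromℤ-* (+ m)    -[1+ n ] = R.trans (fromℤ-*⁻ m (suc n)) (-‿distribʳ-* _ _)
  fromℤ-* -[1+ m ] (+ n)    = R.trans (fromℤ-*⁻ (suc m) n) (-‿distribˡ-* _ _)
  fromℤ-* -[1+ m ] -[1+ n ] = begin
    fromℤ (Sign.+ ℤ.◃ (suc m ℕ.* suc n)) ≈⟨ fromℤ-*⁺ (suc m) (suc n) ⟩
    x * y                           ≈⟨ -‿involutive _ ⟨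
    - - (x * y)                     ≈⟨ -‿cong (-‿distribˡ-* x y) ⟩
    - (- x * y)                     ≈⟨ -‿distribʳ-* (- x) y ⟩
    - x * - y                       ∎
    where
    x = suc m · 1#
    y = suc n · 1#

  almostCommutativeRing : ACR.AlmostCommutativeRing c ℓ
  almostCommutativeRing = ACR.fromCommutativeRing R

  fromℤ-morphism : ℤ.+-*-rawRing ACR.-Raw-AlmostCommutative⟶ almostCommutativeRing
  fromℤ-morphism = record
    { ⟦_⟧    = fromℤ
    ; +-homo = fromℤ-+
    ; *-homo = fromℤ-*
    ; -‿homo = fromℤ-neg
    ; 0-homo = R.refl
    ; 1-homo = +-identityʳ 1#
    }

  private
    _≟_ : ∀ i j → Maybe (fromℤ i ≈ fromℤ j)
    i ≟ j with i ℤ.≟ j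
    ... | yes refl = just R.refl
    ... | no  _    = nothing

  open RingSolver ℤ.+-*-rawRing almostCommutativeRing fromℤ-morphism _≟_ public
    using (solve; _:=_; _:+_; _:*_; _:-_; :-_; con)

-- Fields and valuations

[]-injective : ∀ {i j : ℤ} → _≡_ {A = ℤₘ₀} [ i ] [ j ] → i ≡ j
[]-injective refl = refl

*ᵛ-mono-≤ : ∀ {x y i j} → x ≤ᵛ [ i ] → y ≤ᵛ [ j ] → x *ᵛ y ≤ᵛ [ i ℤ.+ j ]
*ᵛ-mono-≤ (⊥₋≤ _) _       = ⊥₋≤ _
*ᵛ-mono-≤ [ _ ]   (⊥₋≤ _) = ⊥₋≤ _
*ᵛ-mono-≤ [ p ]   [ q ]   = [ ℤ.+-mono-≤ p q ]

≤ᵛ-<ᵛ-connex : ∀ x y → x ≤ᵛ y ⊎ y <ᵛ x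
≤ᵛ-<ᵛ-connex ⊥₋    y     = inj₁ (⊥₋≤ y)
≤ᵛ-<ᵛ-connex [ i ] ⊥₋    = inj₂ ⊥₋<[ i ]
≤ᵛ-<ᵛ-connex [ i ] [ j ] with i ℤ.≤? j
... | yes p = inj₁ [ p ]
... | no ¬p = inj₂ [ ℤ.≰⇒> ¬p ]

-- Exponents are integers, so the strict bounds of `Cauchy` and `_ConvergesTo_` can be traded for
-- the non-strict bounds in which the estimates below are carried.
<ᵛ⇒≤ᵛpred : ∀ {x n} → x <ᵛ [ n ] → x ≤ᵛ [ ℤ.pred n ]
<ᵛ⇒≤ᵛpred ⊥₋<[ _ ] = ⊥₋≤ _
<ᵛ⇒≤ᵛpred [ p ]    = [ ℤ.i<j⇒i≤pred[j] p ]

≤ᵛpred⇒<ᵛ : ∀ {x n} → x ≤ᵛ [ ℤ.pred n ] → x <ᵛ [ n ]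
≤ᵛpred⇒<ᵛ (⊥₋≤ _) = ⊥₋<[ _ ]
≤ᵛpred⇒<ᵛ [ p ]   = [ ℤ.i≤pred[j]⇒i<j p ]

*ᵛ≡1 : ∀ x y → x *ᵛ y ≡ 1ᵛ → ∃[ k ] x ≡ [ k ] × y ≡ [ ℤ.- k ]
*ᵛ≡1 [ i ] [ j ] e = i , refl , cong [_] (begin-equality
  j                        ≡⟨ ℤ.+-identityˡ j ⟨
  0ℤ ℤ.+ j                 ≡⟨ cong (ℤ._+ j) (ℤ.+-inverseˡ i) ⟨
  (ℤ.- i ℤ.+ i) ℤ.+ j      ≡⟨ ℤ.+-assoc (ℤ.- i) i j ⟩
  ℤ.- i ℤ.+ (i ℤ.+ j)      ≡⟨ cong (ℤ._+_ (ℤ.- i)) ([]-injective e) ⟩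
  ℤ.- i ℤ.+ 0ℤ             ≡⟨ ℤ.+-identityʳ _ ⟩
  ℤ.- i                    ∎)
  where open ℤ.≤-Reasoning

module FieldProperties (F : Field c ℓ₁ ℓ₂) where
  open Field F hiding (zero) renaming (refl to ≈-refl; sym to ≈-sym; trans to ≈-trans)
  open CommutativeRing commutativeRing public using (semiring)
  open RingProperties ring public
    using (-0#≈0#; -‿involutive; x∙y⁻¹≈ε⇒x≈y; -1*x≈-x)
  open SemiringSum semiring public
    using (sum; sum-cong-≋; sum-remove; ∑-distrib-+; ∑-comm; *-distribˡ-sum; *-distribʳ-sum;
           sum-replicate; sum-replicate-zero)
  open SemiringExp semiring public using (_^_)
  open SemiringMult semiring public using () renaming (_×_ to _·_)
  open IntegerCoefficients commutativeRing public

  -- The decision behind every pivot search and zero test below. Tightness turns a negative answer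
  -- into an equality; a positive one yields an inverse of `x - 0#`, hence the correction.
  invert : ∀ x → (x ≈ 0#) ⊎ (∃[ y ] x * y ≈ 1#)
  invert x with x #? 0#
  ... | no ¬x#0 = inj₁ (proj₁ (tight x 0#) ¬x#0)
  ... | yes x#0 with #⇒invertible x#0
  ...   | y , _ , e = inj₂ (y , ≈-trans (*-congʳ (≈-sym x-0≈x)) e)
    where
    x-0≈x : x - 0# ≈ x
    x-0≈x = ≈-trans (+-congˡ -0#≈0#) (+-identityʳ x)

  1≉0 : ¬ (1# ≈ 0#)
  1≉0 e = proj₂ (tight 1# 0#) e (invertible⇒# (1# , inverse , ≈-trans (*-comm _ _) inverse))
    where
    inverse : 1# * (1# - 0#) ≈ 1#
    inverse = ≈-trans (*-identityˡ _) (≈-trans (+-congˡ -0#≈0#) (+-identityʳ 1#))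

  unit≉0 : ∀ {x y} → x * y ≈ 1# → ¬ (x ≈ 0#)
  unit≉0 e x≈0 = 1≉0 (≈-trans (≈-sym e) (≈-trans (*-congʳ x≈0) (zeroˡ _)))

  x≈y⇒x-y≈0 : ∀ {x y} → x ≈ y → x - y ≈ 0#
  x≈y⇒x-y≈0 e = ≈-trans (+-congʳ e) (-‿inverseʳ _)

  sum-0 : ∀ {n} (t : Vector Carrier n) → (∀ i → t i ≈ 0#) → sum t ≈ 0#
  sum-0 {n} t e = ≈-trans (sum-cong-≋ e) (sum-replicate-zero n)

  inverse-^ : ∀ {x y} → x * y ≈ 1# → ∀ n → x ^ n * y ^ n ≈ 1#
  inverse-^ e zero    = *-identityˡ 1#
  inverse-^ {x} {y} e (suc n) = begin
    (x * x ^ n) * (y * y ^ n)   ≈⟨ solve 4 (λ a b c d → (a :* b) :* (c :* d) := (a :* c) :* (b :* d))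
                                     ≈-refl x (x ^ n) y (y ^ n) ⟩
    (x * y) * (x ^ n * y ^ n)   ≈⟨ *-cong e (inverse-^ e n) ⟩
    1# * 1#                     ≈⟨ *-identityˡ 1# ⟩
    1#                          ∎
    where open SetoidReasoning setoid

  cancel-inverse : ∀ {x y} → x * y ≈ 1# → ∀ z → x * (y * z) ≈ z
  cancel-inverse {x} {y} e z =
    ≈-trans (≈-sym (*-assoc x y z)) (≈-trans (*-congʳ e) (*-identityˡ z))

module ValuationProperties {F : Field c ℓ₁ ℓ₂} (v : Valuation F) where
  open Field F hiding (zero) renaming (refl to ≈-refl; sym to ≈-sym; trans to ≈-trans)
  open FieldProperties F
  open Valuation v public

  infix 4 _≲_
  _≲_ : Carrier → ℤ → Set
  x ≲ n = val x ≤ᵛ [ n ]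

  Integral : Carrier → Set
  Integral x = x ≲ 0ℤ

  ≲-cong : ∀ {x y n} → x ≈ y → x ≲ n → y ≲ n
  ≲-cong {n = n} e = subst (_≤ᵛ [ n ]) (val-cong e)

  ≲-mono : ∀ {x m n} → m ℤ.≤ n → x ≲ m → x ≲ n
  ≲-mono m≤n p = ≤ᵛ-trans p [ m≤n ]

  ≈0⇒≲ : ∀ {x n} → x ≈ 0# → x ≲ n
  ≈0⇒≲ e = ≤ᵛ-trans (≤ᵛ-reflexive (trans (val-cong e) val-0)) (⊥₋≤ _)

  1-integral : Integral 1#
  1-integral = ≤ᵛ-reflexive val-1

  ≲-+ : ∀ {x y n} → x ≲ n → y ≲ n → x + y ≲ n
  ≲-+ {x} {y} p q = ≤ᵛ-trans (ultrametric x y) (⊔ᵛ-lub p q)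

  ≲-neg : ∀ {x n} → x ≲ n → - x ≲ n
  ≲-neg {x} p = ≤ᵛ-trans (≤ᵛ-reflexive (val-neg x)) p

  ≲-minus : ∀ {x y n} → x ≲ n → y ≲ n → x - y ≲ n
  ≲-minus p q = ≲-+ p (≲-neg q)

  ≲-swap : ∀ {x y n} → x - y ≲ n → y - x ≲ n
  ≲-swap {x} {y} p = ≲-cong (solve 2 (λ x y → :- (x :- y) := y :- x) ≈-refl x y) (≲-neg p)

  ≲-triangle : ∀ {x} y {z n} → x - y ≲ n → y - z ≲ n → x - z ≲ n
  ≲-triangle {x} y {z} p q =
    ≲-cong (solve 3 (λ x y z → (x :- y) :+ (y :- z) := x :- z) ≈-refl x y z) (≲-+ p q)

  ≲-* : ∀ {x y i j} → x ≲ i → y ≲ j → x * y ≲ i ℤ.+ j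
  ≲-* {x} {y} p q = ≤ᵛ-trans (≤ᵛ-reflexive (val-* x y)) (*ᵛ-mono-≤ p q)

  ≲-scale : ∀ {x y n} → Integral x → y ≲ n → x * y ≲ n
  ≲-scale {n = n} p q = ≲-mono (ℤ.≤-reflexive (ℤ.+-identityˡ n)) (≲-* p q)

  ≲-sum : ∀ {n k} (t : Vector Carrier k) → (∀ i → t i ≲ n) → sum t ≲ n
  ≲-sum {k = zero}  t p = ≈0⇒≲ (≈-refl)
  ≲-sum {k = suc k} t p = ≲-+ (p zero) (≲-sum (tail t) (p ∘ suc))

  integral-^ : ∀ {x} → Integral x → ∀ n → Integral (x ^ n)
  integral-^ p zero    = 1-integral
  integral-^ p (suc n) = ≲-scale p (integral-^ p n)

  integral-· : ∀ n → Integral (n · 1#)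
  integral-· zero    = ≈0⇒≲ (≈-refl)
  integral-· (suc n) = ≲-+ 1-integral (integral-· n)

  bound : ∀ x → ∃[ n ] x ≲ + n
  bound x with val x
  ... | ⊥₋    = 0 , ⊥₋≤ _
  ... | [ k ] = ℤ.∣ k ∣ , [ i≤+∣i∣ k ]
    where
    i≤+∣i∣ : ∀ i → i ℤ.≤ + ℤ.∣ i ∣
    i≤+∣i∣ (+ n)      = ℤ.≤-refl
    i≤+∣i∣ ℤ.-[1+ n ] = ℤ.-≤+

  bounds : ∀ {k} (t : Vector Carrier k) → ∃[ n ] (∀ i → t i ≲ + n)
  bounds {zero}  t = 0 , λ ()
  bounds {suc k} t with bound (head t) | bounds (tail t)
  ... | m , p | n , q = m ℕ.⊔ n , λ where
    zero    → ≲-mono (ℤ.+≤+ (ℕ.m≤m⊔n m n)) p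
    (suc i) → ≲-mono (ℤ.+≤+ (ℕ.m≤n⊔m m n)) (q i)

  val-inverse : ∀ {x y} → x * y ≈ 1# → ∃[ k ] val x ≡ [ k ] × val y ≡ [ ℤ.- k ]
  val-inverse {x} {y} e = *ᵛ≡1 (val x) (val y) (trans (sym (val-* x y)) (trans (val-cong e) val-1))

  val≡⊥⇒≈0 : ∀ {x} → val x ≡ ⊥₋ → x ≈ 0#
  val≡⊥⇒≈0 {x} e with invert x
  ... | inj₁ x≈0 = x≈0
  ... | inj₂ (y , xy≈1) with trans (sym e) (proj₁ (proj₂ (val-inverse xy≈1)))
  ...   | ()

  -- The topology is separated, which lets an identity valid up to every power of the uniformizer be
  -- concluded exactly.
  ≲-∀⇒≈0 : ∀ {x} → (∀ k → x ≲ ℤ.- (+ k)) → x ≈ 0#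
  ≲-∀⇒≈0 {x} p with val x in eq
  ... | ⊥₋    = val≡⊥⇒≈0 eq
  ... | [ i ] = ⊥-elim (impossible i p)
    where
    impossible : ∀ i → ¬ (∀ k → [ i ] ≤ᵛ [ ℤ.- (+ k) ])
    impossible (+ n)      q with q 1
    ... | [ () ]
    impossible ℤ.-[1+ n ] q with q (suc (suc n))
    ... | [ ℤ.-≤- r ] = ℕ.1+n≰n r

  ≤ᵛ⇒quotient : ∀ {x y z n} → val x ≤ᵛ [ n ] *ᵛ val y → y * z ≈ 1# → x * z ≲ n
  ≤ᵛ⇒quotient {x} {y} {z} {n} p e with val-inverse e
  ... | k , y≡k , z≡-k = ≲-mono (ℤ.≤-reflexive n+k-k≡n)
    (≲-* (subst (λ γ → val x ≤ᵛ [ n ] *ᵛ γ) y≡k p) (≤ᵛ-reflexive z≡-k))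
    where
    n+k-k≡n : (n ℤ.+ k) ℤ.+ ℤ.- k ≡ n
    n+k-k≡n = trans (ℤ.+-assoc n k (ℤ.- k))
                    (trans (cong (ℤ._+_ n) (ℤ.+-inverseʳ k)) (ℤ.+-identityʳ n))

  quotient-integral : ∀ {x y z} → val x ≤ᵛ val y → y * z ≈ 1# → Integral (x * z)
  quotient-integral {x} {y} p = ≤ᵛ⇒quotient (≤ᵛ-trans p (≤ᵛ-reflexive (sym (1*γ≡γ (val y)))))
    where
    1*γ≡γ : ∀ γ → 1ᵛ *ᵛ γ ≡ γ
    1*γ≡γ ⊥₋    = refl
    1*γ≡γ [ i ] = cong [_] (ℤ.+-identityˡ i)

  quotient-<1 : ∀ {x y z} → val x <ᵛ val y → y * z ≈ 1# → x * z ≲ ℤ.-1ℤ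
  quotient-<1 {x} {y} p = ≤ᵛ⇒quotient (lower p)
    where
    lower : ∀ {γ δ} → γ <ᵛ δ → γ ≤ᵛ [ ℤ.-1ℤ ] *ᵛ δ
    lower ⊥₋<[ _ ] = ⊥₋≤ _
    lower [ p ]    = [ ℤ.i<j⇒i≤pred[j] p ]

-- Linear dependence

module LinearAlgebra (F : Field c ℓ₁ ℓ₂) where
  open Field F hiding (zero) renaming (refl to ≈-refl; sym to ≈-sym; trans to ≈-trans)
  open FieldProperties F
  open SetoidReasoning setoid

  findUnit : ∀ {n} (t : Vector Carrier n) →
    (∀ i → t i ≈ 0#) ⊎ (∃[ i ] ∃[ y ] t i * y ≈ 1#)
  findUnit {zero}  t = inj₁ λ ()
  findUnit {suc n} t with invert (head t) | findUnit (tail t)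
  ... | inj₂ (y , e) | _                = inj₂ (zero , y , e)
  ... | inj₁ _       | inj₂ (i , y , e) = inj₂ (suc i , y , e)
  ... | inj₁ e       | inj₁ es          = inj₁ λ where
    zero    → e
    (suc i) → es i

  sum-*-minus : ∀ {n} (a b d : Vector Carrier n) t →
    sum (λ k → a k * (b k - d k * t)) ≈ sum (λ k → a k * b k) - sum (λ k → a k * d k) * t
  sum-*-minus a b d t = begin
    sum (λ k → a k * (b k - d k * t))
      ≈⟨ sum-cong-≋ (λ k → solve 4 (λ a b d t → a :* (b :- d :* t) := a :* b :+ (a :* d) :* (:- t))
                             ≈-refl (a k) (b k) (d k) t) ⟩
    sum (λ k → a k * b k + (a k * d k) * (- t))
      ≈⟨ ∑-distrib-+ (λ k → a k * b k) (λ k → (a k * d k) * (- t)) ⟩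
    sum (λ k → a k * b k) + sum (λ k → (a k * d k) * (- t))
      ≈⟨ +-congˡ (*-distribʳ-sum (- t) (λ k → a k * d k)) ⟨
    sum (λ k → a k * b k) + sum (λ k → a k * d k) * (- t)
      ≈⟨ solve 3 (λ x y t → x :+ y :* (:- t) := x :- y :* t) ≈-refl
           (sum (λ k → a k * b k)) (sum (λ k → a k * d k)) t ⟩
    sum (λ k → a k * b k) - sum (λ k → a k * d k) * t ∎

  Annihilates : ∀ {n N} → Vector Carrier N → Vector (Vector Carrier n) N → Set ℓ₁
  Annihilates a z = ∀ j → sum (λ i → a i * z i j) ≈ 0#

  -- Some coefficient comes with an inverse: a positive form of not all of them vanishing, which
  -- persists when further coefficients are inserted.
  Dependent : ∀ {n N} → Vector (Vector Carrier n) N → Set _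
  Dependent {N = N} z = ∃[ a ] (∃[ i ] ∃[ y ] a i * y ≈ 1#) × Annihilates {N = N} a z

  Independent : ∀ {n N} → Vector (Vector Carrier n) N → Set _
  Independent z = ∀ a → Annihilates a z → ∀ i → a i ≈ 0#

  -- One step of Gaussian elimination: the pivot row `z i` clears column `zero`, and `reduced` has
  -- one row and one column fewer. Both outcomes for `reduced` are then transported back to `z`.
  module Elimination {n N} (z : Vector (Vector Carrier (suc n)) (suc N))
                     (i : Fin (suc N)) (y : Carrier) (zy≈1 : z i zero * y ≈ 1#) where

    others : Vector (Vector Carrier (suc n)) N
    others = removeAt z i

    ratio : Vector Carrier N
    ratio k = others k zero * y

    eliminated : Vector (Vector Carrier (suc n)) N
    eliminated k j = others k j - ratio k * z i j

    reduced : Vector (Vector Carrier n) N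
    reduced k = tail (eliminated k)

    eliminated-zero : ∀ k → eliminated k zero ≈ 0#
    eliminated-zero k = begin
      o - o * y * u         ≈⟨ solve 3 (λ o y u → o :- o :* y :* u := o :- o :* (u :* y)) ≈-refl o y u ⟩
      o - o * (u * y)       ≈⟨ +-congˡ (-‿cong (*-congˡ zy≈1)) ⟩
      o - o * 1#            ≈⟨ +-congˡ (-‿cong (*-identityʳ o)) ⟩
      o - o                 ≈⟨ -‿inverseʳ o ⟩
      0#                    ∎
      where
      o = others k zero
      u = z i zero

    sum-eliminated : ∀ (a : Vector Carrier N) j →
      sum (λ k → a k * eliminated k j) ≈
      sum (λ k → a k * others k j) - sum (λ k → a k * ratio k) * z i j
    sum-eliminated a j = sum-*-minus a (λ k → others k j) ratio (z i j)

    dependent : Dependent reduced → Dependent z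
    dependent (a , (k , x , ax≈1) , ann) = b , (punchIn i k , x , bx≈1) , annihilates
      where
      r = sum (λ k → a k * ratio k)
      -- A relation among the eliminated rows is one among the other rows up to `r` times the pivot
      -- row, so the pivot row receives the coefficient `- r`.
      b = insertAt a i (- r)
      bx≈1 : b (punchIn i k) * x ≈ 1#
      bx≈1 = ≈-trans (*-congʳ (reflexive (Vector.insertAt-punchIn a i (- r) k))) ax≈1
      eliminated≈0 : ∀ j → sum (λ k → a k * eliminated k j) ≈ 0#
      eliminated≈0 zero    = sum-0 _ λ k → ≈-trans (*-congˡ (eliminated-zero k)) (zeroʳ _)
      eliminated≈0 (suc j) = ann j
      annihilates : Annihilates b z
      annihilates j = begin
        sum (λ k → b k * z k j)
          ≈⟨ sum-remove {i = i} (λ k → b k * z k j) ⟩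
        b i * z i j + sum (λ k → b (punchIn i k) * others k j)
          ≈⟨ +-cong (*-congʳ (reflexive (Vector.insertAt-lookup a i (- r))))
                    (sum-cong-≋ λ k → *-congʳ (reflexive (Vector.insertAt-punchIn a i (- r) k))) ⟩
        - r * z i j + sum (λ k → a k * others k j)
          ≈⟨ solve 3 (λ r t s → :- r :* t :+ s := s :- r :* t) ≈-refl r (z i j) _ ⟩
        sum (λ k → a k * others k j) - r * z i j
          ≈⟨ sum-eliminated a j ⟨
        sum (λ k → a k * eliminated k j)
          ≈⟨ eliminated≈0 j ⟩
        0# ∎

    -- Column `zero` of a relation `b` forces `b i` to be `- r`; the remaining coefficients then
    -- annihilate the reduced rows and vanish, and with them `r` and `b i`.
    independent : Independent reduced → Independent z
    independent ind b ann = λ l → cases l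
      where
      a : Vector Carrier N
      a = removeAt b i
      r = sum (λ k → a k * ratio k)
      expand : ∀ j → b i * z i j + sum (λ k → a k * others k j) ≈ 0#
      expand j = ≈-trans (≈-sym (sum-remove {i = i} (λ k → b k * z k j))) (ann j)
      r≈ : r ≈ sum (λ k → a k * others k zero) * y
      r≈ = ≈-trans (sum-cong-≋ λ k → ≈-sym (*-assoc (a k) (others k zero) y))
                   (≈-sym (*-distribʳ-sum y (λ k → a k * others k zero)))
      bᵢ+r≈0 : b i + r ≈ 0#
      bᵢ+r≈0 = begin
        b i + r                                    ≈⟨ +-cong (*-identityʳ (b i)) (≈-sym r≈) ⟨
        b i * 1# + s * y                           ≈⟨ +-congʳ (*-congˡ zy≈1) ⟨
        b i * (z i zero * y) + s * y               ≈⟨ solve 4 (λ b u y s → b :* (u :* y) :+ s :* y := (b :* u :+ s) :* y)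
                                                        ≈-refl (b i) (z i zero) y s ⟩
        (b i * z i zero + s) * y                   ≈⟨ *-congʳ (expand zero) ⟩
        0# * y                                     ≈⟨ zeroˡ y ⟩
        0#                                         ∎
        where s = sum (λ k → a k * others k zero)
      a-annihilates : Annihilates a reduced
      a-annihilates j = begin
        sum (λ k → a k * reduced k j)              ≈⟨ sum-eliminated a (suc j) ⟩
        s - r * t                                  ≈⟨ solve 4 (λ s r t b → s :- r :* t := (b :* t :+ s) :- (b :+ r) :* t)
                                                        ≈-refl s r t (b i) ⟩
        (b i * t + s) - (b i + r) * t              ≈⟨ +-cong (expand (suc j)) (-‿cong (≈-trans (*-congʳ bᵢ+r≈0) (zeroˡ t))) ⟩
        0# - 0#                                    ≈⟨ -‿inverseʳ 0# ⟩
        0#                                         ∎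
        where
        s = sum (λ k → a k * others k (suc j))
        t = z i (suc j)
      a≈0 : ∀ k → a k ≈ 0#
      a≈0 = ind a a-annihilates
      bᵢ≈0 : b i ≈ 0#
      bᵢ≈0 = begin
        b i           ≈⟨ +-identityʳ (b i) ⟨
        b i + 0#      ≈⟨ +-congˡ (sum-0 _ λ k → ≈-trans (*-congʳ (a≈0 k)) (zeroˡ _)) ⟨
        b i + r       ≈⟨ bᵢ+r≈0 ⟩
        0#            ∎
      cases : ∀ l → b l ≈ 0#
      cases l with i Fin.≟ l
      ... | yes refl = bᵢ≈0
      ... | no i≢l   = ≈-trans (reflexive (cong b (sym (Fin.punchIn-punchOut i≢l)))) (a≈0 (punchOut i≢l))

  -- Each pivot uses up one row and one column, and a column without pivot only enlarges `n`; this
  -- gives `N ≤ n` in the independent case and makes any `n + 1` rows dependent.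
  dependent⊎independent : ∀ {n N} (z : Vector (Vector Carrier n) N) →
    Dependent z ⊎ (Independent z × N ℕ.≤ n)
  dependent⊎independent {zero}  {zero}  z = inj₂ ((λ _ _ ()) , ℕ.z≤n)
  dependent⊎independent {zero}  {suc N} z = inj₁ ((λ _ → 1#) , (zero , 1# , *-identityˡ 1#) , λ ())
  dependent⊎independent {suc n} {N} z with findUnit (λ i → z i zero)
  ... | inj₁ z₀≈0 with dependent⊎independent (λ i → tail (z i))
  ...   | inj₁ (a , nonzero , ann) = inj₁ (a , nonzero , λ where
            zero    → sum-0 _ λ i → ≈-trans (*-congˡ (z₀≈0 i)) (zeroʳ (a i))
            (suc j) → ann j)
  ...   | inj₂ (ind , N≤n) = inj₂ ((λ a ann → ind a (ann ∘ suc)) , ℕ.m≤n⇒m≤1+n N≤n)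
  dependent⊎independent {suc n} {suc N} z | inj₂ (i , y , e) with dependent⊎independent (Elimination.reduced z i y e)
  ... | inj₁ dep         = inj₁ (Elimination.dependent z i y e dep)
  ... | inj₂ (ind , N≤n) = inj₂ (Elimination.independent z i y e ind , ℕ.s≤s N≤n)

  -- Adjoining `u` gives `n + 1` rows in `n` columns, hence a relation. Independence of `z` keeps
  -- the coefficient of `u` from vanishing, so the relation can be solved for `u`. This later
  -- inverts the Gram matrix of the trace form.
  independent⇒spanning : ∀ {n} (z : Vector (Vector Carrier n) n) → Independent z →
    ∀ u → ∃[ a ] ∀ j → sum (λ i → a i * z i j) ≈ u j
  independent⇒spanning {n} z ind u with dependent⊎independent (u Vector.∷ z)
  ... | inj₂ (_ , n<n) = contradiction n<n ℕ.1+n≰n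
  ... | inj₁ (a , (i , x , ax≈1) , ann) with invert (a zero)
  ...   | inj₁ a₀≈0 = contradiction (a≈0 i) (unit≉0 ax≈1)
    where
    a≈0 : ∀ i → a i ≈ 0#
    a≈0 zero    = a₀≈0
    a≈0 (suc i) = ind (tail a) (λ j → begin
      sum (λ i → a (suc i) * z i j)                    ≈⟨ +-identityˡ _ ⟨
      0# + sum (λ i → a (suc i) * z i j)               ≈⟨ +-congʳ (≈-trans (*-congʳ a₀≈0) (zeroˡ (u j))) ⟨
      a zero * u j + sum (λ i → a (suc i) * z i j)     ≈⟨ ann j ⟩
      0#                                               ∎) i
  ...   | inj₂ (y , a₀y≈1) = (λ i → - y * a (suc i)) , λ j → begin
      sum (λ i → - y * a (suc i) * z i j)       ≈⟨ sum-cong-≋ (λ i → *-assoc (- y) (a (suc i)) (z i j)) ⟩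
      sum (λ i → - y * (a (suc i) * z i j))     ≈⟨ *-distribˡ-sum (- y) (λ i → a (suc i) * z i j) ⟨
      - y * s j                                 ≈⟨ solve 4 (λ y s a u → :- y :* s := (a :* y) :* u :- y :* (a :* u :+ s))
                                                     ≈-refl y (s j) (a zero) (u j) ⟩
      a zero * y * u j - y * (a zero * u j + s j)   ≈⟨ +-cong (*-congʳ a₀y≈1) (-‿cong (*-congˡ (ann j))) ⟩
      1# * u j - y * 0#                         ≈⟨ +-cong (*-identityˡ (u j)) (-‿cong (zeroʳ y)) ⟩
      u j - 0#                                  ≈⟨ ≈-trans (+-congˡ -0#≈0#) (+-identityʳ (u j)) ⟩
      u j                                       ∎
    where
    s : Vector Carrier n
    s j = sum (λ i → a (suc i) * z i j)

-- Traces in finite extensions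

module KroneckerDelta (F : Field c ℓ₁ ℓ₂) where
  open Field F hiding (zero) renaming (refl to ≈-refl; sym to ≈-sym; trans to ≈-trans)
  open FieldProperties F

  δ : ∀ {n} → Fin n → Fin n → Carrier
  δ zero    zero    = 1#
  δ zero    (suc j) = 0#
  δ (suc i) zero    = 0#
  δ (suc i) (suc j) = δ i j

  sum-δ : ∀ {n} i (a : Vector Carrier n) → sum (λ j → δ i j * a j) ≈ a i
  sum-δ zero    a = ≈-trans (+-cong (*-identityˡ _) (sum-0 (λ j → 0# * a (suc j)) λ j → zeroˡ _)) (+-identityʳ _)
  sum-δ (suc i) a = ≈-trans (+-cong (zeroˡ _) (sum-δ i (tail a))) (+-identityˡ _)

module ExtensionProperties {F : Field c ℓ₁ ℓ₂} {K : Field c′ ℓ₁′ ℓ₂′}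
                           (K/F : FiniteExtension F K) where
  module F where
    open Field F public
    open FieldProperties F public
    open LinearAlgebra F public
    open KroneckerDelta F public
  open Field K hiding (zero) renaming (refl to ≈-refl; sym to ≈-sym; trans to ≈-trans)
  open FieldProperties K
  open KroneckerDelta K using () renaming (δ to δᴷ; sum-δ to sum-δᴷ)
  open FiniteExtension K/F renaming (degree to n; basis to e)
  open RingMorphisms.IsRingHomomorphism isEmbedding public
    using () renaming (⟦⟧-cong to ι-cong; +-homo to ι-+; *-homo to ι-*; -‿homo to ι-neg;
                       0#-homo to ι-0; 1#-homo to ι-1)
  private module R = SetoidReasoning setoid

  ι-minus : ∀ a b → ι (a F.- b) ≈ ι a - ι b
  ι-minus a b = ≈-trans (ι-+ a _) (+-congˡ (ι-neg b))

  ι-sum : ∀ {N} (a : Vector F.Carrier N) → ι (F.sum a) ≈ sum (ι ∘ a)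
  ι-sum {zero}  a = ι-0
  ι-sum {suc N} a = ≈-trans (ι-+ _ _) (+-congˡ (ι-sum (tail a)))

  lin : ∀ {N} → Vector F.Carrier N → Vector Carrier N → Carrier
  lin a z = sum (λ k → ι (a k) * z k)

  lin-cong : ∀ {N} {a b : Vector F.Carrier N} (z : Vector Carrier N) →
    (∀ i → a i F.≈ b i) → lin a z ≈ lin b z
  lin-cong z a≈b = sum-cong-≋ λ i → *-congʳ (ι-cong (a≈b i))

  lin-minus : ∀ {N} (a b : Vector F.Carrier N) z → lin (λ i → a i F.- b i) z ≈ lin a z - lin b z
  lin-minus a b z = begin
    sum (λ i → ι (a i F.- b i) * z i)
      ≈⟨ sum-cong-≋ (λ i → *-congʳ (ι-minus (a i) (b i))) ⟩
    sum (λ i → (ι (a i) - ι (b i)) * z i)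
      ≈⟨ sum-cong-≋ (λ i → solve 3 (λ a b z → (a :- b) :* z := a :* z :+ :- con (+ 1) :* (b :* z))
                             ≈-refl (ι (a i)) (ι (b i)) (z i)) ⟩
    sum (λ i → ι (a i) * z i + - m * (ι (b i) * z i))
      ≈⟨ ∑-distrib-+ (λ i → ι (a i) * z i) (λ i → - m * (ι (b i) * z i)) ⟩
    lin a z + sum (λ i → - m * (ι (b i) * z i))
      ≈⟨ +-congˡ (*-distribˡ-sum (- m) (λ i → ι (b i) * z i)) ⟨
    lin a z + - m * lin b z
      ≈⟨ solve 2 (λ x y → x :+ :- con (+ 1) :* y := x :- y) ≈-refl (lin a z) (lin b z) ⟩
    lin a z - lin b z ∎
    where
    open R
    m = fromℤ (+ 1)

  lin-lin : ∀ {M N} (a : Vector F.Carrier M) (b : Fin M → Vector F.Carrier N) z →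
    sum (λ i → ι (a i) * lin (b i) z) ≈ lin (λ k → F.sum (λ i → a i F.* b i k)) z
  lin-lin a b z = begin
    sum (λ i → ι (a i) * lin (b i) z)
      ≈⟨ sum-cong-≋ (λ i → *-distribˡ-sum (ι (a i)) (λ k → ι (b i k) * z k)) ⟩
    sum (λ i → sum (λ k → ι (a i) * (ι (b i k) * z k)))
      ≈⟨ ∑-comm (λ i k → ι (a i) * (ι (b i k) * z k)) ⟩
    sum (λ k → sum (λ i → ι (a i) * (ι (b i k) * z k)))
      ≈⟨ sum-cong-≋ (λ k → sum-cong-≋ λ i → ≈-sym
           (≈-trans (*-congʳ (ι-* (a i) (b i k))) (*-assoc _ _ _))) ⟩
    sum (λ k → sum (λ i → ι (a i F.* b i k) * z k))
      ≈⟨ sum-cong-≋ (λ k → *-distribʳ-sum (z k) (λ i → ι (a i F.* b i k))) ⟨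
    sum (λ k → sum (λ i → ι (a i F.* b i k)) * z k)
      ≈⟨ sum-cong-≋ (λ k → *-congʳ (ι-sum (λ i → a i F.* b i k))) ⟨
    lin (λ k → F.sum (λ i → a i F.* b i k)) z ∎
    where open R

  *-lin : ∀ {N} x (a : Vector F.Carrier N) z → x * lin a z ≈ lin a (λ k → x * z k)
  *-lin x a z = ≈-trans (*-distribˡ-sum x (λ k → ι (a k) * z k))
    (sum-cong-≋ λ k → solve 3 (λ x a z → x :* (a :* z) := a :* (x :* z)) ≈-refl x (ι (a k)) (z k))

  lin-δ : ∀ {N} i (z : Vector Carrier N) → lin (F.δ i) z ≈ z i
  lin-δ i z = ≈-trans (sum-cong-≋ λ k → *-congʳ (ι-δ i k)) (sum-δᴷ i z)
    where
    ι-δ : ∀ {N} (i k : Fin N) → ι (F.δ i k) ≈ δᴷ i k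
    ι-δ zero    zero    = ι-1
    ι-δ zero    (suc k) = ι-0
    ι-δ (suc i) zero    = ι-0
    ι-δ (suc i) (suc k) = ι-δ i k

  coord : Carrier → Vector F.Carrier n
  coord y = proj₁ (spanning y)

  lin-coord : ∀ y → lin (coord y) e ≈ y
  lin-coord y = proj₂ (spanning y)

  coord-unique : ∀ {a y} → lin a e ≈ y → ∀ i → a i F.≈ coord y i
  coord-unique {a} {y} eq i = F.x∙y⁻¹≈ε⇒x≈y _ _ (independent (λ i → a i F.- coord y i)
    (≈-trans (lin-minus a (coord y) e) (x≈y⇒x-y≈0 (≈-trans eq (≈-sym (lin-coord y))))) i)

  coord-cong : ∀ {x y} → x ≈ y → ∀ i → coord x i F.≈ coord y i
  coord-cong x≈y = coord-unique (≈-trans (lin-coord _) x≈y)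

  coord-lin : ∀ {N} (a : Vector F.Carrier N) z i →
    coord (lin a z) i F.≈ F.sum (λ k → a k F.* coord (z k) i)
  coord-lin a z i = F.sym (coord-unique (≈-trans
    (≈-sym (lin-lin a (coord ∘ z) e)) (sum-cong-≋ λ k → *-congˡ (lin-coord (z k)))) i)

  LinearlyDependent : ∀ {N} → Vector Carrier N → Set _
  LinearlyDependent z = ∃[ a ] (∃[ i ] ∃[ y ] a i F.* y F.≈ F.1#) × lin a z ≈ 0#

  LinearlyIndependent : ∀ {N} → Vector Carrier N → Set _
  LinearlyIndependent z = ∀ a → lin a z ≈ 0# → ∀ i → a i F.≈ F.0#

  linearlyDependent⊎independent : ∀ {N} (z : Vector Carrier N) →
    LinearlyDependent z ⊎ (LinearlyIndependent z × N ℕ.≤ n)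
  linearlyDependent⊎independent z with F.dependent⊎independent (coord ∘ z)
  ... | inj₂ (ind , N≤n) = inj₂ ((λ a eq → ind a λ j → annihilated a eq j) , N≤n)
    where
    coord-0 : ∀ j → coord 0# j F.≈ F.0#
    coord-0 = independent (coord 0#) (lin-coord 0#)
    annihilated : ∀ a → lin a z ≈ 0# → ∀ j → F.sum (λ k → a k F.* coord (z k) j) F.≈ F.0#
    annihilated a eq j = F.trans (F.sym (coord-lin a z j)) (F.trans (coord-cong eq j) (coord-0 j))
  ... | inj₁ (a , nonzero , ann) = inj₁ (a , nonzero , (begin
    lin a z                                            ≈⟨ sum-cong-≋ (λ k → *-congˡ (lin-coord (z k))) ⟨
    sum (λ k → ι (a k) * lin (coord (z k)) e)          ≈⟨ lin-lin a (coord ∘ z) e ⟩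
    lin (λ j → F.sum (λ k → a k F.* coord (z k) j)) e  ≈⟨ lin-cong e ann ⟩
    lin (λ j → F.0#) e                                 ≈⟨ sum-0 (λ j → ι F.0# * e j) (λ j → ≈-trans (*-congʳ ι-0) (zeroˡ _)) ⟩
    0#                                                 ∎))
    where open R

  tr : Carrier → F.Carrier
  tr x = F.sum (λ i → coord (x * e i) i)

  tr-cong : ∀ {x y} → x ≈ y → tr x F.≈ tr y
  tr-cong x≈y = F.sum-cong-≋ λ i → coord-cong (*-congʳ x≈y) i

  tr-lin : ∀ {N} (a : Vector F.Carrier N) z → tr (lin a z) F.≈ F.sum (λ k → a k F.* tr (z k))
  tr-lin a z = begin
    F.sum (λ i → coord (lin a z * e i) i)
      ≈⟨ F.sum-cong-≋ (λ i → coord-cong (lin-* i) i) ⟩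
    F.sum (λ i → coord (lin a (λ k → z k * e i)) i)
      ≈⟨ F.sum-cong-≋ (λ i → coord-lin a (λ k → z k * e i) i) ⟩
    F.sum (λ i → F.sum (λ k → a k F.* coord (z k * e i) i))
      ≈⟨ F.∑-comm (λ i k → a k F.* coord (z k * e i) i) ⟩
    F.sum (λ k → F.sum (λ i → a k F.* coord (z k * e i) i))
      ≈⟨ F.sum-cong-≋ (λ k → F.*-distribˡ-sum (a k) (λ i → coord (z k * e i) i)) ⟨
    F.sum (λ k → a k F.* tr (z k)) ∎
    where
    open SetoidReasoning F.setoid
    lin-* : ∀ i → lin a z * e i ≈ lin a (λ k → z k * e i)
    lin-* i = ≈-trans (*-distribʳ-sum (e i) (λ k → ι (a k) * z k))
                      (sum-cong-≋ λ k → *-assoc (ι (a k)) (z k) (e i))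

  tr-1 : tr 1# F.≈ n F.· F.1#
  tr-1 = F.trans (F.sum-cong-≋ λ i → F.sym (F.trans (F.reflexive (sym (δ-diag i)))
                    (coord-unique (≈-trans (lin-δ i e) (≈-sym (*-identityˡ (e i)))) i)))
                 (F.sum-replicate n)
    where
    δ-diag : ∀ {n} (i : Fin n) → F.δ i i ≡ F.1#
    δ-diag zero    = refl
    δ-diag (suc i) = δ-diag i

  -- With P and Q the transition matrices between e and z, multiplication by x
  -- has matrix P m Q in the basis e, and tr (P m Q) = tr (m (Q P)) = tr m.
  tr-basis : ∀ {N} (z : Vector Carrier N) → LinearlyIndependent z →
    (P : Fin n → Vector F.Carrier N) → (∀ i → lin (P i) z ≈ e i) →
    ∀ x (m : Fin N → Vector F.Carrier N) → (∀ k → lin (m k) z ≈ x * z k) →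
    tr x F.≈ F.sum (λ k → m k k)
  tr-basis {N} z ind P Pz≈e x m mz≈xz = begin
    F.sum (λ i → coord (x * e i) i)
      ≈⟨ F.sum-cong-≋ (λ i → F.trans (coord-cong (xe≈ i) i) (coord-lin (Pm i) z i)) ⟩
    F.sum (λ i → F.sum (λ l → Pm i l F.* Q l i))
      ≈⟨ F.∑-comm (λ i l → Pm i l F.* Q l i) ⟩
    F.sum (λ l → F.sum (λ i → Pm i l F.* Q l i))
      ≈⟨ F.sum-cong-≋ (λ l → F.sum-cong-≋ λ i → F.*-distribʳ-sum (Q l i) (λ k → P i k F.* m k l)) ⟩
    F.sum (λ l → F.sum (λ i → F.sum (λ k → P i k F.* m k l F.* Q l i)))
      ≈⟨ F.sum-cong-≋ (λ l → F.∑-comm (λ i k → P i k F.* m k l F.* Q l i)) ⟩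
    F.sum (λ l → F.sum (λ k → F.sum (λ i → P i k F.* m k l F.* Q l i)))
      ≈⟨ F.sum-cong-≋ (λ l → F.sum-cong-≋ λ k → F.trans
           (F.sum-cong-≋ λ i → F.solve 3 (λ p m q → p F.:* m F.:* q F.:= (q F.:* p) F.:* m) F.refl (P i k) (m k l) (Q l i))
           (F.sym (F.*-distribʳ-sum (m k l) (λ i → Q l i F.* P i k)))) ⟩
    F.sum (λ l → F.sum (λ k → F.sum (λ i → Q l i F.* P i k) F.* m k l))
      ≈⟨ F.sum-cong-≋ (λ l → F.sum-cong-≋ λ k → F.*-congʳ (QP≈δ l k)) ⟩
    F.sum (λ l → F.sum (λ k → F.δ l k F.* m k l))
      ≈⟨ F.sum-cong-≋ (λ l → F.sum-δ l (λ k → m k l)) ⟩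
    F.sum (λ l → m l l) ∎
    where
    open SetoidReasoning F.setoid
    Q : Fin N → Vector F.Carrier n
    Q = coord ∘ z
    Pm : Fin n → Vector F.Carrier N
    Pm i l = F.sum (λ k → P i k F.* m k l)
    xe≈ : ∀ i → x * e i ≈ lin (Pm i) z
    xe≈ i = R.begin
      x * e i                             R.≈⟨ *-congˡ (Pz≈e i) ⟨
      x * lin (P i) z                     R.≈⟨ *-lin x (P i) z ⟩
      lin (P i) (λ k → x * z k)           R.≈⟨ sum-cong-≋ (λ k → *-congˡ (mz≈xz k)) ⟨
      sum (λ k → ι (P i k) * lin (m k) z) R.≈⟨ lin-lin (P i) m z ⟩
      lin (Pm i) z                        R.∎
    QP : Fin N → Vector F.Carrier N
    QP l k = F.sum (λ i → Q l i F.* P i k)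
    QP≈δ : ∀ l k → QP l k F.≈ F.δ l k
    QP≈δ l k = F.x∙y⁻¹≈ε⇒x≈y _ _ (ind (λ k → QP l k F.- F.δ l k)
      (≈-trans (lin-minus (QP l) (F.δ l) z) (x≈y⇒x-y≈0 (R.begin
        lin (QP l) z                          R.≈⟨ lin-lin (Q l) P z ⟨
        sum (λ i → ι (Q l i) * lin (P i) z)   R.≈⟨ sum-cong-≋ (λ i → *-congˡ (Pz≈e i)) ⟩
        lin (Q l) e                           R.≈⟨ lin-coord (z l) ⟩
        z l                                   R.≈⟨ lin-δ l z ⟨
        lin (F.δ l) z                         R.∎))) k)

  abstract
    -- The Gram matrix `G` sends `coord x` to the vector of the traces `tr (e j * x)`, and `C` is
    -- its left inverse, obtained by writing each `F.δ i` as a combination of the rows of `G`.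
    coord-tr : (∀ k → ¬ (suc k F.· F.1# F.≈ F.0#)) →
      Σ (Fin n → Vector F.Carrier n) λ C → ∀ x i → coord x i F.≈ F.sum (λ j → C i j F.* tr (e j * x))
    coord-tr char0 = C , λ x i → begin
      coord x i
        ≈⟨ F.sum-δ i (coord x) ⟨
      F.sum (λ k → F.δ i k F.* coord x k)
        ≈⟨ F.sum-cong-≋ (λ k → F.trans (F.*-congʳ (F.sym (CG≈δ i k)))
             (F.*-distribʳ-sum (coord x k) (λ j → C i j F.* G j k))) ⟩
      F.sum (λ k → F.sum (λ j → C i j F.* G j k F.* coord x k))
        ≈⟨ F.∑-comm (λ k j → C i j F.* G j k F.* coord x k) ⟩
      F.sum (λ j → F.sum (λ k → C i j F.* G j k F.* coord x k))
        ≈⟨ F.sum-cong-≋ (λ j → F.sum-cong-≋ λ k →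
             F.solve 3 (λ c g x → c F.:* g F.:* x F.:= c F.:* (x F.:* g)) F.refl (C i j) (G j k) (coord x k)) ⟩
      F.sum (λ j → F.sum (λ k → C i j F.* (coord x k F.* G j k)))
        ≈⟨ F.sum-cong-≋ (λ j → F.*-distribˡ-sum (C i j) (λ k → coord x k F.* G j k)) ⟨
      F.sum (λ j → C i j F.* F.sum (λ k → coord x k F.* G j k))
        ≈⟨ F.sum-cong-≋ (λ j → F.*-congˡ (tr-e* x j)) ⟨
      F.sum (λ j → C i j F.* tr (e j * x)) ∎
      where
      open SetoidReasoning F.setoid
      G : Fin n → Vector F.Carrier n
      G j k = tr (e j * e k)
      tr-e* : ∀ x j → tr (e j * x) F.≈ F.sum (λ k → coord x k F.* G j k)
      tr-e* x j = F.trans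
        (tr-cong (≈-trans (*-congˡ (≈-sym (lin-coord x))) (*-lin (e j) (coord x) e)))
        (tr-lin (coord x) (λ k → e j * e k))
      -- `char0` speaks of successors only, so degree zero is excluded separately: there `1#` would
      -- be an empty sum.
      n·1≉0 : ¬ (n F.· F.1# F.≈ F.0#)
      n·1≉0 = nonzero n e (lin-coord 1#)
        where
        nonzero : ∀ m {a} (z : Vector Carrier m) → lin a z ≈ 1# → ¬ (m F.· F.1# F.≈ F.0#)
        nonzero zero    z 0≈1 _ = 1≉0 (≈-sym 0≈1)
        nonzero (suc m) z _     = char0 m
      G-independent : F.Independent G
      G-independent a aG≈0 = independent a y≈0
        where
        y : Carrier
        y = lin a e
        tr-y* : ∀ k → tr (y * e k) F.≈ F.0#
        tr-y* k = F.trans (tr-cong (≈-trans (*-distribʳ-sum (e k) (λ j → ι (a j) * e j))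
                                    (sum-cong-≋ λ j → *-assoc (ι (a j)) (e j) (e k))))
                          (F.trans (tr-lin a (λ j → e j * e k)) (aG≈0 k))
        y≈0 : y ≈ 0#
        y≈0 with invert y
        ... | inj₁ y≈0 = y≈0
        ... | inj₂ (u , yu≈1) = contradiction (F.trans (F.sym tr-1) (F.trans (F.sym (tr-cong yu≈1))
                (F.trans (tr-cong (≈-trans (*-congˡ (≈-sym (lin-coord u))) (*-lin y (coord u) e)))
                (F.trans (tr-lin (coord u) (λ k → y * e k))
                  (F.sum-0 _ λ k → F.trans (F.*-congˡ (tr-y* k)) (F.zeroʳ (coord u k))))))) n·1≉0
      C : Fin n → Vector F.Carrier n
      C i = proj₁ (F.independent⇒spanning G G-independent (F.δ i))
      CG≈δ : ∀ i k → F.sum (λ j → C i j F.* G j k) F.≈ F.δ i k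
      CG≈δ i = proj₂ (F.independent⇒spanning G G-independent (F.δ i))

-- Limits and uniformizers

-∣i∣≤i : ∀ i → ℤ.- (+ ℤ.∣ i ∣) ℤ.≤ i
-∣i∣≤i (+ n)      = ℤ.neg-≤-pos
-∣i∣≤i ℤ.-[1+ n ] = ℤ.≤-refl

module Limits {F : Field c ℓ₁ ℓ₂} (v : Valuation F) where
  open Field F hiding (zero) renaming (refl to ≈-refl; sym to ≈-sym; trans to ≈-trans)
  open FieldProperties F
  open ValuationProperties v

  infix 4 _⟶_
  -- Small radii suffice for convergence, and indexing them by naturals matches divisibility by
  -- powers of a uniformizer.
  _⟶_ : (ℕ → Carrier) → Carrier → Set
  s ⟶ x = ∀ k → ∃[ N ] ∀ {i} → i ℕ.≥ N → s i - x ≲ ℤ.- (+ k)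

  ⟶⇒ConvergesTo : ∀ {s x} → s ⟶ x → _ConvergesTo_ v s x
  ⟶⇒ConvergesTo s⟶x n with s⟶x ℤ.∣ ℤ.pred n ∣
  ... | N , p = N , λ i≥N → ≤ᵛpred⇒<ᵛ (≲-mono (-∣i∣≤i (ℤ.pred n)) (p i≥N))

  ConvergesTo⇒⟶ : ∀ {s x} → _ConvergesTo_ v s x → s ⟶ x
  ConvergesTo⇒⟶ s→x k with s→x (ℤ.suc (ℤ.- (+ k)))
  ... | N , p = N , λ i≥N → ≲-mono (ℤ.≤-reflexive (ℤ.pred-suc _)) (<ᵛ⇒≤ᵛpred (p i≥N))

  -- By the ultrametric inequality, differences of consecutive terms bound all later differences.
  -- Hence the sequence is Cauchy, and comparison with a term beyond both `N` and `k` transfers the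
  -- same bound to the limit, without loss.
  limit : IsComplete v → ∀ s → (∀ k → s (suc k) - s k ≲ ℤ.- (+ k)) →
    ∃[ x ] ∀ k → s k - x ≲ ℤ.- (+ k)
  limit complete s step = x , λ k →
    let N , p = ConvergesTo⇒⟶ {s = s} s→x k
    in ≲-triangle (s (N ℕ.⊔ k)) (≲-swap (tails (ℕ.m≤n⊔m N k))) (p (ℕ.m≤m⊔n N k))
    where
    tails′ : ∀ {k i} → k ℕ.≤′ i → s i - s k ≲ ℤ.- (+ k)
    tails′ ℕ.≤′-refl     = ≈0⇒≲ (-‿inverseʳ _)
    tails′ (ℕ.≤′-step k≤i) = ≲-triangle (s _)
      (≲-mono (ℤ.neg-mono-≤ (ℤ.+≤+ (ℕ.≤′⇒≤ k≤i))) (step _)) (tails′ k≤i)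
    tails : ∀ {k i} → k ℕ.≤ i → s i - s k ≲ ℤ.- (+ k)
    tails k≤i = tails′ (ℕ.≤⇒≤′ k≤i)
    cauchy : Cauchy v s
    cauchy n = N , λ i≥N j≥N → ≤ᵛpred⇒<ᵛ (≲-mono (-∣i∣≤i (ℤ.pred n))
                     (≲-triangle (s N) (tails i≥N) (≲-swap (tails j≥N))))
      where N = ℤ.∣ ℤ.pred n ∣
    x    = proj₁ (complete s cauchy)
    s→x = proj₂ (complete s cauchy)

module Uniformizer {F : Field c ℓ₁ ℓ₂} (v : Valuation F)
                   (π : Field.Carrier F) (val-π : Valuation.val v π ≡ [ ℤ.-1ℤ ]) where
  open Field F hiding (zero) renaming (refl to ≈-refl; sym to ≈-sym; trans to ≈-trans)
  open FieldProperties F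
  open ValuationProperties v

  private
    π-unit : ∃[ ϖ ] π * ϖ ≈ 1#
    π-unit with invert π
    ... | inj₂ unit = unit
    ... | inj₁ π≈0 with trans (sym val-π) (trans (val-cong π≈0) val-0)
    ...   | ()

  ϖ : Carrier
  ϖ = proj₁ π-unit

  πϖ≈1 : π * ϖ ≈ 1#
  πϖ≈1 = proj₂ π-unit

  π-≲ : π ≲ ℤ.-1ℤ
  π-≲ = ≤ᵛ-reflexive val-π

  ϖ-≲ : ϖ ≲ ℤ.1ℤ
  ϖ-≲ with val-inverse πϖ≈1
  ... | k , p , q with trans (sym val-π) p
  ...   | refl = ≤ᵛ-reflexive q

  π^-≲ : ∀ k → π ^ k ≲ ℤ.- (+ k)
  π^-≲ zero    = 1-integral
  π^-≲ (suc k) = ≲-mono (ℤ.≤-reflexive (sym (ℤ.neg-distrib-+ ℤ.1ℤ (+ k)))) (≲-* π-≲ (π^-≲ k))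

  ϖ^-≲ : ∀ k → ϖ ^ k ≲ + k
  ϖ^-≲ zero    = 1-integral
  ϖ^-≲ (suc k) = ≲-* ϖ-≲ (ϖ^-≲ k)

  divide : ∀ {x} k → x ≲ ℤ.- (+ k) → ∃[ y ] Integral y × x ≈ π ^ k * y
  divide {x} k p = ϖ ^ k * x , ≲-mono (ℤ.≤-reflexive (ℤ.+-inverseʳ (+ k))) (≲-* (ϖ^-≲ k) p) ,
    ≈-sym (cancel-inverse (inverse-^ πϖ≈1 k) x)

-- Elements of the unit ball have integral trace

^ᵛ-≤ : ∀ {γ i} → γ ≤ᵛ [ i ] → ∀ d → γ ^ᵛ d ≤ᵛ [ + d ℤ.* i ]
^ᵛ-≤ {γ} {i} p zero    = ≤ᵛ-reflexive (cong [_] (sym (ℤ.*-zeroˡ i)))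
^ᵛ-≤ {γ} {i} p (suc d) = ≤ᵛ-trans (*ᵛ-mono-≤ p (^ᵛ-≤ p d)) (≤ᵛ-reflexive (cong [_] (sym (ℤ.suc-* (+ d) i))))

-- A positive power only shrinks a value at most 1, so small elements of the base stay at least as
-- small in K, whatever the exponent in `Extends`.
≤ᵛ⇒^ᵛ-≤ : ∀ {γ} k → γ ≤ᵛ [ ℤ.- (+ k) ] → ∀ {d} → d ℕ.≥ 1 → γ ^ᵛ d ≤ᵛ [ ℤ.- (+ k) ]
≤ᵛ⇒^ᵛ-≤ k p {suc d} _ = ≤ᵛ-trans (^ᵛ-≤ p (suc d)) [ ℤ.≤-trans
  (ℤ.≤-reflexive (trans (sym (ℤ.neg-distribʳ-* (+ suc d) (+ k))) (cong ℤ.-_ (sym (ℤ.pos-* (suc d) k)))))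
  (ℤ.neg-mono-≤ (ℤ.+≤+ (ℕ.m≤m+n k (d ℕ.* k)))) ]

pairs : ∀ {a} {A : Set a} {m n} (f : Fin m → Fin n → A) →
  ∃[ N ] Σ (Vector A N) λ z → (∀ k → ∃[ i ] ∃[ j ] f i j ≡ z k) × (∀ i j → ∃[ k ] z k ≡ f i j)
pairs {m = m} {n} f = m ℕ.* n , (λ k → uncurry f (remQuot {m} n k)) ,
  (λ k → proj₁ (remQuot {m} n k) , proj₂ (remQuot {m} n k) , refl) ,
  (λ i j → combine i j , cong (uncurry f) (Fin.remQuot-combine i j))

module ValuedExtension {F : Field c ℓ₁ ℓ₂} {K : Field c′ ℓ₁′ ℓ₂′} (K/F : FiniteExtension F K)
    (v : Valuation F) (complete : IsComplete v)
    (π : Field.Carrier F) (val-π : Valuation.val v π ≡ [ ℤ.-1ℤ ])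
    (w : Valuation K) (extends : Extends K/F v w) where
  open ExtensionProperties K/F public
  module V where
    open ValuationProperties v public
    open Limits v public
    open Uniformizer v π val-π public
  open Field K hiding (zero) renaming (refl to ≈-refl; sym to ≈-sym; trans to ≈-trans)
  open FieldProperties K
  open ValuationProperties w
  open FiniteExtension K/F renaming (degree to n; basis to e)
  module ≈ = SetoidReasoning setoid

  ι-≲ : ∀ {a} k → a V.≲ ℤ.- (+ k) → ι a ≲ ℤ.- (+ k)
  ι-≲ {a} k p = ≤ᵛ-trans (≤ᵛ-reflexive (proj₂ (proj₂ extends) a)) (≤ᵛ⇒^ᵛ-≤ k p (proj₁ (proj₂ extends)))

  ι-integral : ∀ {a} → V.Integral a → Integral (ι a)
  ι-integral = ι-≲ 0

  -- Membership in the lattice generated by `z` over the unit ball of F. The coefficients are kept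
  -- as data because they become the entries of the matrix whose trace is taken.
  record Span {N} (z : Vector Carrier N) (y : Carrier) : Set (c ⊔ ℓ₁′) where
    constructor span
    field
      coeffs      : Vector F.Carrier N
      integral    : ∀ i → V.Integral (coeffs i)
      coeffs-lin  : lin coeffs z ≈ y

  span-cong : ∀ {N} {z : Vector Carrier N} {x y} → x ≈ y → Span z x → Span z y
  span-cong x≈y (span a int eq) = span a int (≈-trans eq x≈y)

  span-trans : ∀ {M N} {z : Vector Carrier M} {z′ : Vector Carrier N} →
    (∀ i → Span z′ (z i)) → ∀ {y} → Span z y → Span z′ y
  span-trans {z = z} {z′} h (span a int eq) = span
    (λ k → F.sum (λ i → a i F.* Span.coeffs (h i) k))
    (λ k → V.≲-sum _ λ i → V.≲-scale (int i) (Span.integral (h i) k))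
    (≈-trans (≈-sym (lin-lin a (λ i → Span.coeffs (h i)) z′))
             (≈-trans (sum-cong-≋ λ i → *-congˡ (Span.coeffs-lin (h i))) eq))

  span-generator : ∀ {N} (z : Vector Carrier N) i → Span z (z i)
  span-generator z i = span (F.δ i) (integral-δ i) (lin-δ i z)
    where
    integral-δ : ∀ {N} (i j : Fin N) → V.Integral (F.δ i j)
    integral-δ zero    zero    = V.1-integral
    integral-δ zero    (suc j) = V.≈0⇒≲ F.refl
    integral-δ (suc i) zero    = V.≈0⇒≲ F.refl
    integral-δ (suc i) (suc j) = integral-δ i j

  span-0 : ∀ {N} {z : Vector Carrier N} {y} → y ≈ 0# → Span z y
  span-0 {z = z} y≈0 = span (λ _ → F.0#) (λ _ → V.≈0⇒≲ F.refl)
    (≈-trans (sum-0 (λ i → ι F.0# * z i) λ i → ≈-trans (*-congʳ ι-0) (zeroˡ (z i))) (≈-sym y≈0))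

  span-+-scale : ∀ {N} {z : Vector Carrier N} {x y t} → Span z x → V.Integral t → Span z y →
    Span z (x + ι t * y)
  span-+-scale {z = z} {x} {y} {t} (span a int-a a≈x) int-t (span b int-b b≈y) =
    span (λ i → a i F.+ t F.* b i) (λ i → V.≲-+ (int-a i) (V.≲-scale int-t (int-b i))) (≈.begin
      sum (λ i → ι (a i F.+ t F.* b i) * z i)
        ≈.≈⟨ sum-cong-≋ (λ i → ≈-trans (*-congʳ (≈-trans (ι-+ _ _) (+-congˡ (ι-* _ _))))
             (solve 4 (λ a t b z → (a :+ t :* b) :* z := a :* z :+ t :* (b :* z)) ≈-refl (ι (a i)) (ι t) (ι (b i)) (z i))) ⟩
      sum (λ i → ι (a i) * z i + ι t * (ι (b i) * z i))
        ≈.≈⟨ ∑-distrib-+ (λ i → ι (a i) * z i) (λ i → ι t * (ι (b i) * z i)) ⟩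
      lin a z + sum (λ i → ι t * (ι (b i) * z i))
        ≈.≈⟨ +-cong a≈x (≈-trans (≈-sym (*-distribˡ-sum (ι t) (λ i → ι (b i) * z i))) (*-congˡ b≈y)) ⟩
      x + ι t * y ≈.∎)

  span-map : ∀ {N} {z z′ : Vector Carrier N} x {y} → (∀ i → z′ i ≈ x * z i) → Span z y → Span z′ (x * y)
  span-map {z = z} x z′≈xz (span a int eq) = span a int
    (≈-trans (sum-cong-≋ λ i → *-congˡ (z′≈xz i)) (≈-trans (≈-sym (*-lin x a z)) (*-congˡ eq)))

  maximum : ∀ {N} (a : Vector F.Carrier (suc N)) → ∃[ i ] ∀ j → V.val (a j) ≤ᵛ V.val (a i)
  maximum {zero}  a = zero , λ { zero → ≤ᵛ-reflexive refl }
  maximum {suc N} a with maximum (tail a)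
  ... | i , max with ≤ᵛ-<ᵛ-connex (V.val (a zero)) (V.val (a (suc i)))
  ...   | inj₁ a₀≤aᵢ = suc i , λ { zero → a₀≤aᵢ ; (suc j) → max j }
  ...   | inj₂ aᵢ<a₀ = zero , λ { zero → ≤ᵛ-reflexive refl ; (suc j) → ≤ᵛ-trans (max j) (<ᵛ⇒≤ᵛ aᵢ<a₀) }
    where
    <ᵛ⇒≤ᵛ : ∀ {x y} → x <ᵛ y → x ≤ᵛ y
    <ᵛ⇒≤ᵛ ⊥₋<[ _ ] = ⊥₋≤ _
    <ᵛ⇒≤ᵛ [ p ]    = [ ℤ.<⇒≤ p ]

  -- Division by a coefficient of largest value keeps all the others integral, so the corresponding
  -- generator is an integral combination of the rest. This is why finitely generated lattices over
  -- a valuation ring are free.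
  dependent⇒redundant : ∀ {N} {z : Vector Carrier (suc N)} → LinearlyDependent z →
    ∃[ i ] Span (removeAt z i) (z i)
  dependent⇒redundant {z = z} (a , (k , y , aₖy≈1) , az≈0) with maximum a
  ... | i , max with F.invert (a i)
  ...   | inj₁ aᵢ≈0 = contradiction (aₖ≈0 _ refl (max k)) (F.unit≉0 aₖy≈1)
    where
    aₖ≈0 : ∀ γ → V.val (a k) ≡ γ → γ ≤ᵛ V.val (a i) → a k F.≈ F.0#
    aₖ≈0 γ eq p with subst (γ ≤ᵛ_) (trans (V.val-cong aᵢ≈0) V.val-0) p
    ... | ⊥₋≤ _ = V.val≡⊥⇒≈0 eq
  ...   | inj₂ (u , aᵢu≈1) = i , span (λ j → F.- (b j F.* u)) (λ j → V.≲-neg (V.quotient-integral (max (punchIn i j)) aᵢu≈1))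
    (≈.begin
      sum (λ j → ι (F.- (b j F.* u)) * z′ j)
        ≈.≈⟨ sum-cong-≋ (λ j → ≈-trans (*-congʳ (≈-trans (ι-neg _) (-‿cong (ι-* _ _))))
             (solve 3 (λ b u z → :- (b :* u) :* z := :- u :* (b :* z)) ≈-refl (ι (b j)) (ι u) (z′ j))) ⟩
      sum (λ j → - ι u * (ι (b j) * z′ j))
        ≈.≈⟨ *-distribˡ-sum (- ι u) (λ j → ι (b j) * z′ j) ⟨
      - ι u * lin b z′
        ≈.≈⟨ solve 4 (λ a u z s → :- u :* s := (a :* u) :* z :- u :* (a :* z :+ s)) ≈-refl (ι (a i)) (ι u) (z i) (lin b z′) ⟩
      (ι (a i) * ι u) * z i - ι u * (ι (a i) * z i + lin b z′)
        ≈.≈⟨ +-cong (*-congʳ (≈-trans (≈-sym (ι-* (a i) u)) (≈-trans (ι-cong aᵢu≈1) ι-1)))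
             (-‿cong (*-congˡ (≈-trans (≈-sym (sum-remove {i = i} (λ k → ι (a k) * z k))) az≈0))) ⟩
      1# * z i - ι u * 0#
        ≈.≈⟨ +-cong (*-identityˡ (z i)) (-‿cong (zeroʳ (ι u))) ⟩
      z i - 0#
        ≈.≈⟨ ≈-trans (+-congˡ -0#≈0#) (+-identityʳ (z i)) ⟩
      z i ≈.∎)
    where
    b  = removeAt a i
    z′ = removeAt z i

  -- Redundant generators can be discarded until the lattice spanned by z is
  -- free on z, and then tr x is the trace of an integral matrix.
  stable-lattice⇒tr-integral : ∀ {N} (z : Vector Carrier N) x → (∀ k → Span z (x * z k)) →
    (∀ j → Span z (e j)) → V.Integral (tr x)
  stable-lattice⇒tr-integral {N} z x stable e∈z with linearlyDependent⊎independent z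
  ... | inj₂ (ind , _) = V.≲-cong
    (F.sym (tr-basis z ind (Span.coeffs ∘ e∈z) (Span.coeffs-lin ∘ e∈z) x (Span.coeffs ∘ stable) (Span.coeffs-lin ∘ stable)))
    (V.≲-sum _ λ k → Span.integral (stable k) k)
  stable-lattice⇒tr-integral {zero}  z x stable e∈z | inj₁ (_ , (() , _) , _)
  stable-lattice⇒tr-integral {suc N} z x stable e∈z | inj₁ dep =
    stable-lattice⇒tr-integral (removeAt z i) x
      (λ k → span-trans z∈z′ (stable (punchIn i k))) (λ j → span-trans z∈z′ (e∈z j))
    where
    i = proj₁ (dependent⇒redundant {z = z} dep)
    z∈z′ : ∀ k → Span (removeAt z i) (z k)
    z∈z′ k with i Fin.≟ k
    ... | yes refl = proj₂ (dependent⇒redundant {z = z} dep)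
    ... | no i≢k = subst (λ k → Span (removeAt z i) (z k)) (Fin.punchIn-punchOut i≢k)
                     (span-generator (removeAt z i) _)

  -- Integral equations for elements of the unit ball

  module Integrality (x : Carrier) (x-integral : Integral x) where

    pow : ∀ {m} → Vector Carrier m
    pow i = x ^ toℕ i

    Low : ℕ → Carrier → Set _
    Low m = Span (pow {m})

    -- Polynomials in `x` in Horner form, with no record of the degree. `Low m` is used where the
    -- number of coefficients matters; the quotients by `π` appearing in the division need only lie
    -- in this ring.
    data O[x] (y : Carrier) : Set (c ⊔ c′ ⊔ ℓ₁′) where
      nil  : y ≈ 0# → O[x] y
      cons : ∀ {a z} → V.Integral a → O[x] z → y ≈ ι a + x * z → O[x] y

    O[x]-cong : ∀ {y z} → y ≈ z → O[x] y → O[x] z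
    O[x]-cong y≈z (nil y≈0)      = nil (≈-trans (≈-sym y≈z) y≈0)
    O[x]-cong y≈z (cons int p eq) = cons int p (≈-trans (≈-sym y≈z) eq)

    O[x]-+ : ∀ {y z} → O[x] y → O[x] z → O[x] (y + z)
    O[x]-+ (nil y≈0) q = O[x]-cong (≈-sym (≈-trans (+-congʳ y≈0) (+-identityˡ _))) q
    O[x]-+ p@(cons _ _ _) (nil z≈0) = O[x]-cong (≈-sym (≈-trans (+-congˡ z≈0) (+-identityʳ _))) p
    O[x]-+ (cons {a} {y} int-a p eq) (cons {b} {z} int-b q eq′) = cons (V.≲-+ int-a int-b) (O[x]-+ p q)
      (≈-trans (+-cong eq eq′) (≈-trans
        (solve 5 (λ a b x y z → (a :+ x :* y) :+ (b :+ x :* z) := (a :+ b) :+ x :* (y :+ z)) ≈-refl (ι a) (ι b) x y z)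
        (+-congʳ (≈-sym (ι-+ a b)))))

    O[x]-scale : ∀ {t y} → V.Integral t → O[x] y → O[x] (ι t * y)
    O[x]-scale int-t (nil y≈0) = nil (≈-trans (*-congˡ y≈0) (zeroʳ _))
    O[x]-scale {t} int-t (cons {a} {y} int-a p eq) = cons (V.≲-scale int-t int-a) (O[x]-scale int-t p)
      (≈-trans (*-congˡ eq) (≈-trans
        (solve 4 (λ t a x y → t :* (a :+ x :* y) := t :* a :+ x :* (t :* y)) ≈-refl (ι t) (ι a) x y)
        (+-congʳ (≈-sym (ι-* t a)))))

    O[x]-x* : ∀ {y} → O[x] y → O[x] (x * y)
    O[x]-x* p = cons (V.≈0⇒≲ F.refl) p (≈-sym (≈-trans (+-congʳ ι-0) (+-identityˡ _)))

    O[x]-pow* : ∀ m {y} → O[x] y → O[x] (x ^ m * y)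
    O[x]-pow* zero    p = O[x]-cong (≈-sym (*-identityˡ _)) p
    O[x]-pow* (suc m) p = O[x]-cong (≈-sym (*-assoc x (x ^ m) _)) (O[x]-x* (O[x]-pow* m p))

    O[x]-1 : O[x] 1#
    O[x]-1 = cons V.1-integral (nil ≈-refl)
      (≈-sym (≈-trans (+-cong ι-1 (zeroʳ x)) (+-identityʳ 1#)))

    O[x]-neg : ∀ {y} → O[x] y → O[x] (- y)
    O[x]-neg p = O[x]-cong (≈-trans (*-congʳ (≈-trans (ι-neg F.1#) (-‿cong ι-1))) (-1*x≈-x _))
      (O[x]-scale (V.≲-neg V.1-integral) p)

    O[x]⇒integral : ∀ {y} → O[x] y → Integral y
    O[x]⇒integral (nil y≈0)       = ≈0⇒≲ y≈0
    O[x]⇒integral (cons int p eq) =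
      ≲-cong (≈-sym eq) (≲-+ (ι-integral int) (≲-scale x-integral (O[x]⇒integral p)))

    lin-pow : ∀ {m} (a : Vector F.Carrier (suc m)) →
      lin a pow ≈ ι (head a) + x * lin (tail a) pow
    lin-pow a = +-cong (*-identityʳ _) (≈-sym (*-lin x (tail a) pow))

    low-cons : ∀ {m a y} → V.Integral a → Low m y → Low (suc m) (ι a + x * y)
    low-cons {a = a} int-a (span b int-b eq) = span (a Vector.∷ b)
      (λ { zero → int-a ; (suc i) → int-b i }) (≈-trans (lin-pow (a Vector.∷ b)) (+-congˡ (*-congˡ eq)))

    -- `low-cons` extends a combination at the constant term and shifts the others up; reduction by
    -- the relation replaces the top power, which is split off here.
    low-snoc : ∀ {m y} → Low (suc m) y → ∃[ t ] ∃[ l ] V.Integral t × Low m l × y ≈ l + ι t * x ^ m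
    low-snoc {zero}  (span a int eq) = head a , 0# , int zero , span-0 ≈-refl , ≈-trans (≈-sym eq) (+-comm _ _)
    low-snoc {suc m} {y} (span a int eq) with low-snoc {m} (span (tail a) (int ∘ suc) ≈-refl)
    ... | t , l , int-t , low , tail≈ = t , ι (head a) + x * l , int-t , low-cons (int zero) low , (≈.begin
      y                                        ≈.≈⟨ eq ⟨
      lin a pow                                ≈.≈⟨ lin-pow a ⟩
      ι (head a) + x * lin (tail a) pow        ≈.≈⟨ +-congˡ (*-congˡ tail≈) ⟩
      ι (head a) + x * (l + ι t * x ^ m)       ≈.≈⟨ solve 5 (λ a x l t u → a :+ x :* (l :+ t :* u) := (a :+ x :* l) :+ t :* (x :* u))
                                                     ≈-refl (ι (head a)) x l (ι t) (x ^ m) ⟩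
      (ι (head a) + x * l) + ι t * x ^ suc m   ≈.∎)

    low⇒O[x] : ∀ {m y} → Low m y → O[x] y
    low⇒O[x] {zero}  (span a int eq) = nil (≈-sym eq)
    low⇒O[x] {suc m} (span a int eq) =
      cons (int zero) (low⇒O[x] (span (tail a) (int ∘ suc) ≈-refl)) (≈-trans (≈-sym eq) (lin-pow a))

    -- lead is the last coefficient of maximal valuation; the coefficients after it
    -- are therefore divisible by π relative to lead.
    record Normalised (y : Carrier) : Set (c ⊔ ℓ₁ ⊔ c′ ⊔ ℓ₁′) where
      field
        {lead inv} : F.Carrier
        {low high} : Carrier
        degree   : ℕ
        unit     : lead F.* inv F.≈ F.1#
        low-part : Low degree low
        high-part : O[x] high
        factor   : y ≈ ι lead * (low + x ^ degree * (1# + ι π * (x * high)))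

    -- The head is compared with the leading coefficient of the tail. On a tie the tail keeps the
    -- lead, which selects the last maximum. If the head is strictly larger it takes over in degree
    -- 0, and the whole tail becomes a multiple of `π` relative to it.
    normalise : ∀ {N} (a : Vector F.Carrier N) → (∀ i → a i F.≈ F.0#) ⊎ Normalised (lin a pow)
    normalise {zero}  a = inj₁ λ ()
    normalise {suc N} a with normalise (tail a)
    ... | inj₁ tail≈0 with F.invert (head a)
    ...   | inj₁ head≈0 = inj₁ λ { zero → head≈0 ; (suc i) → tail≈0 i }
    ...   | inj₂ (u , unit) = inj₂ record
      { degree    = 0
      ; unit      = unit
      ; low-part  = span-0 ≈-refl
      ; high-part = nil ≈-refl
      ; factor    = ≈.begin
          lin a pow                              ≈.≈⟨ lin-pow a ⟩
          ι (head a) + x * lin (tail a) pow      ≈.≈⟨ +-cong (≈-sym (*-identityʳ _)) (*-congˡ (≈-trans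
                                                      (lin-cong pow tail≈0)
                                                      (sum-0 {N} (λ i → ι F.0# * pow i) λ i → ≈-trans (*-congʳ ι-0) (zeroˡ _)))) ⟩
          -- Since `1#` is the variable `o` of the solver, the identity holds only up to the term in
          -- `o * o - o`, which the next step removes.
          ι (head a) * 1# + x * 0#               ≈.≈⟨ solve 4 (λ a o x p → a :* o :+ x :* con 0ℤ :=
                                                          a :* (con 0ℤ :+ o :* (o :+ p :* (x :* con 0ℤ))) :- a :* (o :* o :- o))
                                                        ≈-refl (ι (head a)) 1# x (ι π) ⟩
          ι (head a) * (0# + 1# * (1# + ι π * (x * 0#))) - ι (head a) * (1# * 1# - 1#)
            ≈.≈⟨ ≈-trans (+-congˡ (≈-trans (-‿cong (≈-trans (*-congˡ (x≈y⇒x-y≈0 (*-identityˡ 1#))) (zeroʳ _))) -0#≈0#)) (+-identityʳ _) ⟩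
          ι (head a) * (0# + 1# * (1# + ι π * (x * 0#))) ≈.∎
      }
    normalise {suc N} a | inj₂ r = go (≤ᵛ-<ᵛ-connex (V.val (head a)) (V.val lead)) (F.invert (head a))
      where
      open Normalised r
      U = 1# + ι π * (x * high)
      U∈O[x] : O[x] U
      U∈O[x] = O[x]-+ O[x]-1 (O[x]-scale (V.≲-mono ℤ.-≤+ V.π-≲) (O[x]-x* high-part))
      eq : lin a pow ≈ ι (head a) + x * (ι lead * (low + x ^ degree * U))
      eq = ≈-trans (lin-pow a) (+-congˡ (*-congˡ factor))
      go : V.val (head a) ≤ᵛ V.val lead ⊎ V.val lead <ᵛ V.val (head a) →
           (head a F.≈ F.0#) ⊎ (∃[ u ] head a F.* u F.≈ F.1#) →
           (∀ i → a i F.≈ F.0#) ⊎ Normalised (lin a pow)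
      go (inj₁ head≤lead) _ = inj₂ record
        { degree    = suc degree
        ; unit      = unit
        ; low-part  = low-cons (V.quotient-integral head≤lead unit) low-part
        ; high-part = high-part
        ; factor    = ≈.begin
            lin a pow
              ≈.≈⟨ eq ⟩
            ι (head a) + x * (ι lead * (low + x ^ degree * U))
              ≈.≈⟨ +-congʳ (ι-cong (F.trans (F.sym (F.*-identityʳ _)) (F.trans (F.*-congˡ (F.sym unit))
                     (F.solve 3 (λ h l i → h F.:* (l F.:* i) F.:= l F.:* (h F.:* i)) F.refl (head a) lead inv)))) ⟩
            ι (lead F.* (head a F.* inv)) + x * (ι lead * (low + x ^ degree * U))
              ≈.≈⟨ +-congʳ (ι-* lead _) ⟩
            ι lead * ι (head a F.* inv) + x * (ι lead * (low + x ^ degree * U))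
              ≈.≈⟨ solve 6 (λ d h x l p U → d :* h :+ x :* (d :* (l :+ p :* U)) := d :* ((h :+ x :* l) :+ (x :* p) :* U))
                     ≈-refl (ι lead) (ι (head a F.* inv)) x low (x ^ degree) U ⟩
            ι lead * ((ι (head a F.* inv) + x * low) + x ^ suc degree * U) ≈.∎
        }
      go (inj₂ lead<head) (inj₁ head≈0) with subst (V.val lead <ᵛ_) (trans (V.val-cong head≈0) V.val-0) lead<head
      ... | ()
      -- Values being integral, strict inequality puts the quotient of the two coefficients at
      -- valuation at most that of `π`, so a full factor `π` splits off.
      go (inj₂ lead<head) (inj₂ (u , head*u≈1)) with V.divide 1 (V.quotient-<1 lead<head head*u≈1)
      ... | q , int-q , lead*u≈πq = inj₂ record
        { degree    = 0
        ; unit      = head*u≈1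
        ; low-part  = span-0 ≈-refl
        ; high-part = O[x]-scale int-q (O[x]-+ (low⇒O[x] low-part) (O[x]-pow* degree U∈O[x]))
        ; factor    = ≈.begin
            lin a pow
              ≈.≈⟨ eq ⟩
            ι h + x * (ι lead * Y)
              ≈.≈⟨ +-congˡ (*-congˡ (*-congʳ (≈-trans (ι-cong lead≈) (≈-trans (ι-* h _) (*-congˡ (ι-* π q)))))) ⟩
            ι h + x * (ι h * (ι π * ι q) * Y)
              ≈.≈⟨ +-congʳ (*-identityʳ (ι h)) ⟨
            ι h * 1# + x * (ι h * (ι π * ι q) * Y)
              ≈.≈⟨ solve 6 (λ h o x p q Y → h :* o :+ x :* (h :* (p :* q) :* Y) := h :* (o :+ p :* (x :* (q :* Y))))
                     ≈-refl (ι h) 1# x (ι π) (ι q) Y ⟩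
            ι h * (1# + ι π * (x * (ι q * Y)))
              ≈.≈⟨ *-congˡ (≈-trans (+-identityˡ _) (*-identityˡ _)) ⟨
            ι h * (0# + 1# * (1# + ι π * (x * (ι q * Y)))) ≈.∎
        }
        where
        h = head a
        Y = low + x ^ degree * U
        lead≈ : lead F.≈ h F.* (π F.* q)
        lead≈ = F.trans (F.sym (F.cancel-inverse head*u≈1 lead))
          (F.*-congˡ (F.trans (F.*-comm u lead) (F.trans lead*u≈πq (F.*-congʳ (F.*-identityʳ π)))))

    normalised-relation : Normalised 0#
    normalised-relation with linearlyDependent⊎independent (pow {suc n})
    ... | inj₂ (_ , n<n) = contradiction n<n ℕ.1+n≰n
    ... | inj₁ (a , (i , y , aᵢy≈1) , a·pow≈0) with normalise a
    ...   | inj₁ a≈0 = contradiction (a≈0 i) (F.unit≉0 aᵢy≈1)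
    ...   | inj₂ r   = record
      { degree = degree ; unit = unit ; low-part = low-part ; high-part = high-part
      ; factor = ≈-trans (≈-sym a·pow≈0) factor }
      where open Normalised r

    -- After division by `lead`, the summand 1 of the factor `1# + ι π * (x * high)` contributes the
    -- power to be isolated, and the other summand goes into the multiple of `π`.
    x^m≈low+π*high : ∃[ m ] ∃[ l ] ∃[ r ] Low m l × O[x] r × x ^ m ≈ l + ι π * r
    x^m≈low+π*high = m , 0# + ι (F.- F.1#) * low , - (x ^ m * (x * high)) ,
      span-+-scale (span-0 ≈-refl) (V.≲-neg V.1-integral) low-part ,
      O[x]-neg (O[x]-pow* m (O[x]-x* high-part)) , (≈.begin
        x ^ m
          ≈.≈⟨ solve 5 (λ p l u f o → p := (:- l :+ u :* (:- (p :* f))) :+ ((l :+ p :* (o :+ u :* f)) :- p :* (o :- con (+ 1))))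
                 ≈-refl (x ^ m) low (ι π) (x * high) 1# ⟩
        (- low + ι π * - (x ^ m * (x * high))) + (low + x ^ m * (1# + ι π * (x * high)) - x ^ m * (1# - fromℤ (+ 1)))
          ≈.≈⟨ ≈-trans (+-congˡ (≈-trans (+-cong factor≈0 (≈-trans (-‿cong (≈-trans (*-congˡ (x≈y⇒x-y≈0 (≈-sym (+-identityʳ 1#)))) (zeroʳ _))) -0#≈0#))
                 (+-identityʳ 0#))) (+-identityʳ _) ⟩
        - low + ι π * - (x ^ m * (x * high))
          ≈.≈⟨ +-congʳ (≈-trans (+-identityˡ _) (≈-trans (*-congʳ (≈-trans (ι-neg F.1#) (-‿cong ι-1))) (-1*x≈-x low))) ⟨
        (0# + ι (F.- F.1#) * low) + ι π * - (x ^ m * (x * high)) ≈.∎)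
      where
      open Normalised normalised-relation renaming (degree to m)
      factor≈0 : low + x ^ m * (1# + ι π * (x * high)) ≈ 0#
      factor≈0 = ≈-trans (≈-sym (cancel-inverse
          (≈-trans (≈-sym (ι-* inv lead)) (≈-trans (ι-cong (F.trans (F.*-comm inv lead) unit)) ι-1)) _))
        (≈-trans (*-congˡ (≈-sym factor)) (zeroʳ (ι inv)))

    module Division {m l₀ r₀} (low₀ : Low m l₀) (O[r₀] : O[x] r₀) (x^m≈ : x ^ m ≈ l₀ + ι π * r₀) where

      -- Modulo `π`, every element of `O[x]` reduces to powers below the `m`-th. In the Horner
      -- recursion, multiplying the reduced part by `x` overflows in a single term, a multiple of
      -- `x ^ m`, to which `x^m≈` applies.
      divideByπ : ∀ {r} → O[x] r → ∃[ l ] ∃[ r′ ] Low m l × O[x] r′ × r ≈ l + ι π * r′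
      divideByπ (nil r≈0) = 0# , 0# , span-0 ≈-refl , nil ≈-refl ,
        ≈-trans r≈0 (≈-sym (≈-trans (+-identityˡ _) (zeroʳ _)))
      divideByπ {r} (cons {a} {y} int p r≈a+xy) with divideByπ p
      ... | l , y′ , low , O[y′] , y≈l+πy′ with low-snoc (low-cons int low)
      ...   | t , l′ , int-t , low′ , a+xl≈ =
        l′ + ι t * l₀ , ι t * r₀ + x * y′ , span-+-scale low′ int-t low₀ ,
        O[x]-+ (O[x]-scale int-t O[r₀]) (O[x]-x* O[y′]) , (≈.begin
          r                                       ≈.≈⟨ r≈a+xy ⟩
          ι a + x * y                             ≈.≈⟨ +-congˡ (*-congˡ y≈l+πy′) ⟩
          ι a + x * (l + ι π * y′)                ≈.≈⟨ solve 5 (λ a x l p y → a :+ x :* (l :+ p :* y) := (a :+ x :* l) :+ p :* (x :* y))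
                                                        ≈-refl (ι a) x l (ι π) y′ ⟩
          (ι a + x * l) + ι π * (x * y′)          ≈.≈⟨ +-congʳ (≈-trans a+xl≈ (+-congˡ (*-congˡ x^m≈))) ⟩
          (l′ + ι t * (l₀ + ι π * r₀)) + ι π * (x * y′)
            ≈.≈⟨ solve 7 (λ l t k p r x y → (l :+ t :* (k :+ p :* r)) :+ p :* (x :* y) := (l :+ t :* k) :+ p :* (t :* r :+ x :* y))
                   ≈-refl l′ (ι t) l₀ (ι π) r₀ x y′ ⟩
          (l′ + ι t * l₀) + ι π * (ι t * r₀ + x * y′) ≈.∎)

      record Approximation (k : ℕ) : Set (c ⊔ ℓ₁ ⊔ c′ ⊔ ℓ₁′) where
        field
          coeff     : Vector F.Carrier m
          rest      : Carrier
          rest∈O[x] : O[x] rest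
          expansion : x ^ m ≈ lin coeff pow + ι (π F.^ k) * rest

      -- Reducing `rest` modulo `π` changes the coefficients by multiples of `π ^ k` only, so they
      -- form convergent sequences.
      refine : ∀ {k} → (A : Approximation k) → Σ (Approximation (suc k)) λ A′ →
        ∀ i → Approximation.coeff A′ i F.- Approximation.coeff A i V.≲ ℤ.- (+ k)
      refine {k} A with divideByπ (Approximation.rest∈O[x] A)
      ... | l , r′ , span b int-b b·pow≈l , O[r′] , rest≈l+πr′ = record
        -- The correction is added by subtracting its negative, so that `lin-minus` applies.
        { coeff     = λ i → coeff i F.- F.- (π F.^ k F.* b i)
        ; rest      = r′
        ; rest∈O[x] = O[r′]
        ; expansion = ≈.begin
            x ^ m
              ≈.≈⟨ expansion ⟩
            lin coeff pow + ι (π F.^ k) * rest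
              ≈.≈⟨ +-congˡ (*-congˡ (≈-trans rest≈l+πr′ (+-congʳ (≈-sym b·pow≈l)))) ⟩
            lin coeff pow + ι (π F.^ k) * (lin b pow + ι π * r′)
              ≈.≈⟨ solve 5 (λ s q l p r → s :+ q :* (l :+ p :* r) := (s :- (:- q) :* l) :+ (p :* q) :* r)
                     ≈-refl (lin coeff pow) (ι (π F.^ k)) (lin b pow) (ι π) r′ ⟩
            (lin coeff pow - (- ι (π F.^ k)) * lin b pow) + (ι π * ι (π F.^ k)) * r′
              ≈.≈⟨ +-cong (≈-trans (lin-minus coeff _ pow) (+-congˡ (-‿cong scaled))) (*-congʳ (ι-* π _)) ⟨
            lin (λ i → coeff i F.- F.- (π F.^ k F.* b i)) pow + ι (π F.^ suc k) * r′ ≈.∎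
        } , λ i → V.≲-cong (F.solve 2 (λ a b → b F.:= (a F.:- F.:- b) F.:- a) F.refl (coeff i) (π F.^ k F.* b i))
                           (V.≲-mono (ℤ.≤-reflexive (ℤ.+-identityʳ _)) (V.≲-* (V.π^-≲ k) (int-b i)))
        where
        open Approximation A
        scaled : lin (λ i → F.- (π F.^ k F.* b i)) pow ≈ - ι (π F.^ k) * lin b pow
        scaled = ≈-trans
          (sum-cong-≋ λ i → ≈-trans (*-congʳ (≈-trans (ι-neg _) (-‿cong (ι-* _ _))))
            (solve 3 (λ q b z → :- (q :* b) :* z := :- q :* (b :* z)) ≈-refl (ι (π F.^ k)) (ι (b i)) (pow i)))
          (≈-sym (*-distribˡ-sum (- ι (π F.^ k)) (λ i → ι (b i) * pow i)))

      approximation : ∀ k → Approximation k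
      approximation zero    = record
        { coeff     = λ _ → F.0#
        ; rest      = x ^ m
        ; rest∈O[x] = O[x]-cong (*-identityʳ _) (O[x]-pow* m O[x]-1)
        ; expansion = ≈-sym (≈-trans (+-cong (sum-0 {m} (λ i → ι F.0# * pow i) λ i → ≈-trans (*-congʳ ι-0) (zeroˡ _))
                                             (≈-trans (*-congʳ ι-1) (*-identityˡ _)))
                                     (+-identityˡ _))
        }
      approximation (suc k) = proj₁ (refine (approximation k))

      -- Here `x-integral` enters: it keeps the powers of `x` and all `rest` in the unit ball, so
      -- the limit coefficients satisfy the relation up to every power of `π`. They are integral
      -- because the sequences start at zero and the first bound is 1.
      limit-relation : (A : ∀ k → Approximation k) →
        (∀ i → Approximation.coeff (A 0) i F.≈ F.0#) →
        (∀ k i → Approximation.coeff (A (suc k)) i F.- Approximation.coeff (A k) i V.≲ ℤ.- (+ k)) →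
        Low m (x ^ m)
      limit-relation A A₀≈0 step = span β β-integral (≈-sym (x∙y⁻¹≈ε⇒x≈y _ _ (≲-∀⇒≈0 λ k →
          let open Approximation (A k) in
          ≲-cong (≈.begin
              lin (λ i → coeff i F.- β i) pow + ι (π F.^ k) * rest
                ≈.≈⟨ +-congʳ (lin-minus coeff β pow) ⟩
              (lin coeff pow - lin β pow) + ι (π F.^ k) * rest
                ≈.≈⟨ solve 3 (λ s b r → (s :- b) :+ r := (s :+ r) :- b) ≈-refl (lin coeff pow) (lin β pow) (ι (π F.^ k) * rest) ⟩
              (lin coeff pow + ι (π F.^ k) * rest) - lin β pow
                ≈.≈⟨ +-congʳ expansion ⟨
              x ^ m - lin β pow ≈.∎)
            (≲-+ (≲-sum _ λ i → ≲-scale′ (ι-≲ k (proj₂ (limits i) k)) (integral-^ x-integral (toℕ i)))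
                 (≲-scale′ (ι-≲ k (V.π^-≲ k)) (O[x]⇒integral rest∈O[x]))))))
        where
        limits : ∀ i → ∃[ b ] ∀ k → Approximation.coeff (A k) i F.- b V.≲ ℤ.- (+ k)
        limits i = V.limit complete (λ k → Approximation.coeff (A k) i)
          λ k → step k i
        β : Vector F.Carrier m
        β i = proj₁ (limits i)
        β-integral : ∀ i → V.Integral (β i)
        β-integral i = V.≲-cong
          (F.solve 2 (λ a b → a F.:- (a F.:- b) F.:= b) F.refl (Approximation.coeff (A 0) i) (β i))
          (V.≲-minus (V.≈0⇒≲ (A₀≈0 i)) (proj₂ (limits i) 0))
        ≲-scale′ : ∀ {y z n} → y ≲ n → Integral z → y * z ≲ n
        ≲-scale′ p q = ≲-cong (*-comm _ _) (≲-scale q p)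

      integral-relation : Low m (x ^ m)
      integral-relation = limit-relation approximation (λ i → F.refl) (λ k → proj₂ (refine (approximation k)))

    module Stable {m} (relation : Low m (x ^ m)) where

      low-x* : ∀ {y} → Low m y → Low m (x * y)
      low-x* low with low-snoc (low-cons (V.≈0⇒≲ F.refl) low)
      ... | t , l , int-t , low′ , 0+xy≈l+tx^m =
        span-cong (≈-trans (≈-sym 0+xy≈l+tx^m) (≈-trans (+-congʳ ι-0) (+-identityˡ _)))
          (span-+-scale low′ int-t relation)

      low-1 : Low m 1#
      low-1 = go m relation
        where
        go : ∀ m → Low m (x ^ m) → Low m 1#
        -- `x ^ 0` is `1#`, so for `m = 0` the relation is already the claim.
        go zero    low = low
        go (suc m) _   = span-generator pow zero

      low*e : ∀ {N} {z : Vector Carrier N} j → (∀ (i : Fin m) → Span z (e j * pow i)) →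
        ∀ {y} → Low m y → Span z (e j * y)
      low*e j generated low = span-trans generated (span-map (e j) (λ _ → ≈-refl) low)

      -- Powers of `x` alone would give only the subfield generated by `x`. Multiplying them by the
      -- basis yields a lattice that contains every `e j`, so the trace computed on it is that of K.
      generated⇒tr-integral : ∀ {N} (z : Vector Carrier N) →
        (∀ k → ∃[ i ] ∃[ j ] e j * pow {m} i ≡ z k) → (∀ i j → ∃[ k ] z k ≡ e j * pow {m} i) →
        V.Integral (tr x)
      generated⇒tr-integral z z∈ ∈z = stable-lattice⇒tr-integral z x stable
        (λ j → span-cong (*-identityʳ (e j)) (low*e j (generated j) low-1))
        where
        generated : ∀ j i → Span z (e j * pow {m} i)
        generated j i = let k , eq = ∈z i j in span-cong (reflexive eq) (span-generator z k)
        stable : ∀ k → Span z (x * z k)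
        stable k with z∈ k
        ... | i , j , eq = span-cong
          (≈-trans (solve 3 (λ x e p → e :* (x :* p) := x :* (e :* p)) ≈-refl x (e j) (pow i)) (*-congˡ (reflexive eq)))
          (low*e j (generated j) (low-x* (span-generator pow i)))

      stable-tr-integral : V.Integral (tr x)
      stable-tr-integral with pairs (λ (i : Fin m) j → e j * pow i)
      ... | _ , z , z∈ , ∈z = generated⇒tr-integral z z∈ ∈z

    abstract
      tr-integral : V.Integral (tr x)
      tr-integral = go x^m≈low+π*high
        where
        go : ∃[ m ] ∃[ l ] ∃[ r ] Low m l × O[x] r × x ^ m ≈ l + ι π * r → V.Integral (tr x)
        go (m , l , r , low , O[r] , x^m≈) =
          Stable.stable-tr-integral (Division.integral-relation low O[r] x^m≈)

-- Completeness and residue classes of a finite extension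

m-[m+k]≡-k : ∀ m k → + m ℤ.- + (m ℕ.+ k) ≡ ℤ.- (+ k)
m-[m+k]≡-k m k = trans (ℤ.m-n≡m⊖n m (m ℕ.+ k)) (trans (cong (ℤ._⊖ (m ℕ.+ k)) (sym (ℕ.+-identityʳ m)))
  (trans (ℤ.+-cancelˡ-⊖ m 0 k) (ℤ.⊖-≤ ℕ.z≤n)))

-[m+k]+m≡-k : ∀ m k → ℤ.- (+ (m ℕ.+ k)) ℤ.+ + m ≡ ℤ.- (+ k)
-[m+k]+m≡-k m k = trans (ℤ.+-comm (ℤ.- (+ (m ℕ.+ k))) (+ m)) (m-[m+k]≡-k m k)

vectors : List A → ∀ n → List (Vector A n)
vectors xs zero    = Vector.[] ∷ []
vectors xs (suc n) = cartesianProductWith Vector._∷_ xs (vectors xs n)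

vectors⁺ : ∀ {xs : List A} {n} {P : Fin n → A → Set ℓᴾ} → (∀ i → Any (P i) xs) →
  Any (λ t → ∀ i → P i (t i)) (vectors xs n)
vectors⁺ {n = zero}  h = here λ ()
vectors⁺ {n = suc n} h = Any.cartesianProductWith⁺ Vector._∷_
  (λ p ps → λ { zero → p ; (suc i) → ps i }) (h zero) (vectors⁺ (h ∘ suc))

eventually-∀ : ∀ {n} {P : Fin n → ℕ → Set ℓᴾ} → (∀ i → ∃[ N ] ∀ {j} → j ℕ.≥ N → P i j) →
  ∃[ N ] ∀ {j} → j ℕ.≥ N → ∀ i → P i j
eventually-∀ {n = zero}  h = 0 , λ _ ()
eventually-∀ {n = suc n} h with h zero | eventually-∀ (h ∘ suc)
... | M , p | N , q = M ℕ.⊔ N , λ where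
  j≥ zero    → p (ℕ.≤-trans (ℕ.m≤m⊔n M N) j≥)
  j≥ (suc i) → q (ℕ.≤-trans (ℕ.m≤n⊔m M N) j≥) i

module FiniteResidues {F : Field c ℓ₁ ℓ₂} (v : Valuation F)
    (π : Field.Carrier F) (val-π : Valuation.val v π ≡ [ ℤ.-1ℤ ])
    (digits : List (Field.Carrier F))
    (digit : ∀ x → Valuation.val v x ≤ᵛ 1ᵛ → Any (λ d → Valuation.val v (Field._-_ F x d) ≤ᵛ [ ℤ.-1ℤ ]) digits)
    where
  open Field F hiding (zero) renaming (refl to ≈-refl; sym to ≈-sym; trans to ≈-trans)
  open FieldProperties F
  open ValuationProperties v
  open Uniformizer v π val-π

  expansions : ℕ → List Carrier
  expansions zero    = 0# ∷ []
  expansions (suc k) = concatMap (λ d → map (λ r → d + π * r) (expansions k)) digits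

  expansion : ∀ k {x} → Integral x → Any (λ r → x - r ≲ ℤ.- (+ k)) (expansions k)
  expansion zero    int = here (≲-minus int (≈0⇒≲ ≈-refl))
  expansion (suc k) {x} int = Any.concatMap⁺ _ (Any.map (Any.map⁺ ∘ shift) (digit x int))
    where
    shift : ∀ {d} → x - d ≲ ℤ.-1ℤ → Any (λ r → x - (d + π * r) ≲ ℤ.- (+ suc k)) (expansions k)
    shift {d} p with divide 1 p
    ... | y , int-y , x-d≈πy = Any.map (λ {r} y-r → ≲-cong (x-[d+πr] r)
          (≲-mono (ℤ.≤-reflexive (sym (ℤ.neg-distrib-+ ℤ.1ℤ (+ k)))) (≲-* π-≲ y-r))) (expansion k int-y)
      where
      x-[d+πr] : ∀ r → π * (y - r) ≈ x - (d + π * r)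
      x-[d+πr] r = begin
        π * (y - r)            ≈⟨ solve 3 (λ p y r → p :* (y :- r) := p :* y :- p :* r) ≈-refl π y r ⟩
        π * y - π * r          ≈⟨ +-congʳ (≈-trans x-d≈πy (*-congʳ (*-identityʳ π))) ⟨
        (x - d) - π * r        ≈⟨ solve 3 (λ x d r → (x :- d) :- r := x :- (d :+ r)) ≈-refl x d (π * r) ⟩
        x - (d + π * r)        ∎
        where open SetoidReasoning setoid

  approximants : ℕ → ℕ → List Carrier
  approximants N k = map (ϖ ^ N *_) (expansions (N ℕ.+ k))

  -- Scaling by `π ^ N` brings `x` into the unit ball and scaling back costs `N` digits, hence
  -- expansions of length `N + k`.
  approximant : ∀ N k {x} → x ≲ + N → Any (λ r → x - r ≲ ℤ.- (+ k)) (approximants N k)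
  approximant N k {x} x≲N = Any.map⁺ (Any.map (λ {r} p → ≲-cong
      (≈-trans (solve 4 (λ u p x r → u :* (p :* x :- r) := p :* (u :* x) :- u :* r) ≈-refl (ϖ ^ N) (π ^ N) x r)
               (+-congʳ (cancel-inverse (inverse-^ πϖ≈1 N) x)))
      (≲-mono (ℤ.≤-reflexive (m-[m+k]≡-k N k)) (≲-* (ϖ^-≲ N) p)))
    (expansion (N ℕ.+ k) (≲-mono (ℤ.≤-reflexive (ℤ.+-inverseˡ (+ N))) (≲-* (π^-≲ N) x≲N))))

module LocalFieldExtension {F : Field c ℓ₁ ℓ₂} {K : Field c′ ℓ₁′ ℓ₂′} (K/F : FiniteExtension F K)
    (v : Valuation F) (complete : IsComplete v)
    (π : Field.Carrier F) (val-π : Valuation.val v π ≡ [ ℤ.-1ℤ ])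
    (w : Valuation K) (extends : Extends K/F v w)
    (char0 : ∀ k → ¬ Field._≈_ F (FieldProperties._·_ F (suc k) (Field.1# F)) (Field.0# F)) where
  open ValuedExtension K/F v complete π val-π w extends
  open Field K hiding (zero) renaming (refl to ≈-refl; sym to ≈-sym; trans to ≈-trans)
  open FieldProperties K
  open ValuationProperties w
  open Limits w
  open FiniteExtension K/F renaming (degree to n; basis to e)

  bounds₂ : ∀ {M N} (C : Fin M → Vector F.Carrier N) → ∃[ b ] ∀ i j → C i j V.≲ + b
  bounds₂ {zero}  C = 0 , λ ()
  bounds₂ {suc M} C with V.bounds (C zero) | bounds₂ (C ∘ suc)
  ... | a , p | b , q = a ℕ.⊔ b , λ where
    zero    j → V.≲-mono (ℤ.+≤+ (ℕ.m≤m⊔n a b)) (p j)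
    (suc i) j → V.≲-mono (ℤ.+≤+ (ℕ.m≤n⊔m a b)) (q i j)

  tr-ι* : ∀ a y → tr (ι a * y) F.≈ a F.* tr y
  tr-ι* a y = F.trans (tr-cong (≈-sym (+-identityʳ (ι a * y))))
    (F.trans (tr-lin {1} (const a) (const y)) (F.+-identityʳ (a F.* tr y)))

  coord-ι* : ∀ a y i → coord (ι a * y) i F.≈ a F.* coord y i
  coord-ι* a y i = F.trans (coord-cong (≈-sym (+-identityʳ (ι a * y))) i)
    (F.trans (coord-lin {1} (const a) (const y) i) (F.+-identityʳ (a F.* coord y i)))

  coord-minus : ∀ x y i → coord x i F.- coord y i F.≈ coord (x - y) i
  coord-minus x y = coord-unique (≈-trans (lin-minus (coord x) (coord y) e)
    (+-cong (lin-coord x) (-‿cong (lin-coord y))))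

  -- The ramification index when `w` is surjective; `e` already names the basis.
  d : ℕ
  d = proj₁ extends

  tr-ι-cancel : ∀ {a b} → b F.* a F.≈ F.1# → ∀ y → b F.* tr (ι a * y) F.≈ tr y
  tr-ι-cancel {a} {b} ba≈1 y = F.trans (F.*-congˡ (tr-ι* a y)) (F.cancel-inverse ba≈1 (tr y))

  coord-ι-cancel : ∀ {a b} → b F.* a F.≈ F.1# → ∀ y i → b F.* coord (ι a * y) i F.≈ coord y i
  coord-ι-cancel {a} {b} ba≈1 y i =
    F.trans (F.*-congˡ (coord-ι* a y i)) (F.cancel-inverse ba≈1 (coord y i))

  ϖ^π^≈1 : ∀ k → V.ϖ F.^ k F.* π F.^ k F.≈ F.1#
  ϖ^π^≈1 = F.inverse-^ (F.trans (F.*-comm V.ϖ π) V.πϖ≈1)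

  -- Integrality of the trace is available on the unit ball only; linearity over F extends it to
  -- elements that `π ^ M` moves there, at the cost of `M`.
  tr-≲ : ∀ {y} M → ι (π F.^ M) * y ≲ 0ℤ → tr y V.≲ + M
  tr-≲ {y} M int = V.≲-cong {V.ϖ F.^ M F.* tr (ι (π F.^ M) * y)} {tr y} (tr-ι-cancel (ϖ^π^≈1 M) y)
    (V.≲-mono (ℤ.≤-reflexive (ℤ.+-identityʳ (+ M)))
      (V.≲-* {V.ϖ F.^ M} {tr (ι (π F.^ M) * y)} (V.ϖ^-≲ M) (Integrality.tr-integral (ι (π F.^ M) * y) int)))

  abstract
    lin-≲ : ∃[ M ] ∀ k a → (∀ i → a i V.≲ ℤ.- (+ (M ℕ.+ k))) → lin a e ≲ ℤ.- (+ k)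
    lin-≲ = M , λ k a a≲ → ≲-sum _ λ i →
        ≲-mono (ℤ.≤-reflexive (-[m+k]+m≡-k M k)) (≲-* (ι-≲ (M ℕ.+ k) (a≲ i)) (proj₂ (bounds e) i))
      where
      M : ℕ
      M = proj₁ (bounds e)

    -- The bound adds two losses: `M` makes the products `e j * x` integral after scaling, and `B`
    -- bounds the inverse Gram matrix.
    coord-bound : ∃[ N ] ∀ {x} → Integral x → ∀ i → coord x i V.≲ + N
    coord-bound = B ℕ.+ M , λ {x} int i → V.≲-cong (F.sym (proj₂ (coord-tr char0) x i))
        (V.≲-sum (λ j → C i j F.* tr (e j * x)) λ j → V.≲-* (C≲B i j) (tr-≲ M (scaled int j)))
      where
      M B : ℕ
      M = proj₁ (bounds e)
      C : Fin n → Vector F.Carrier n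
      C = proj₁ (coord-tr char0)
      B = proj₁ (bounds₂ C)
      C≲B : ∀ i j → C i j V.≲ + B
      C≲B = proj₂ (bounds₂ C)
      scaled : ∀ {x} → Integral x → ∀ j → Integral (ι (π F.^ M) * (e j * x))
      scaled {x} int j = ≲-cong (*-assoc (ι (π F.^ M)) (e j) x)
        (≲-scale (≲-mono (ℤ.≤-reflexive (ℤ.+-inverseˡ (+ M))) (≲-* (ι-≲ M (V.π^-≲ M)) (proj₂ (bounds e) j))) int)

    -- Multiplication by the image of `V.ϖ ^ l` can raise the exponent of `w` by `d * l`, hence the
    -- factor `d` in the hypothesis. With `l = N + k` the scaled element is integral, and its
    -- coordinate bound `N` leaves precision `k`.
    coord-≲ : ∃[ N ] ∀ k {x} → x ≲ ℤ.- (+ (d ℕ.* (N ℕ.+ k))) → ∀ i → coord x i V.≲ ℤ.- (+ k)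
    coord-≲ = N , λ k {x} x≲ i →
        V.≲-cong (coord-ι-cancel (F.inverse-^ V.πϖ≈1 (N ℕ.+ k)) x i)
          (V.≲-mono (ℤ.≤-reflexive (-[m+k]+m≡-k N k))
            (V.≲-* (V.π^-≲ (N ℕ.+ k)) (proj₂ coord-bound (scaled-integral (N ℕ.+ k) x≲) i)))
      where
      N : ℕ
      N = proj₁ coord-bound
      scaled-integral : ∀ l {x} → x ≲ ℤ.- (+ (d ℕ.* l)) → Integral (ι (V.ϖ F.^ l) * x)
      scaled-integral l p = ≲-mono (ℤ.≤-reflexive (trans (cong (ℤ._+ ℤ.- (+ (d ℕ.* l))) (sym (ℤ.pos-* d l)))
          (ℤ.+-inverseʳ (+ (d ℕ.* l)))))
        (≲-* (≤ᵛ-trans (≤ᵛ-reflexive (proj₂ (proj₂ extends) _)) (^ᵛ-≤ (V.ϖ^-≲ l) d)) p)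

  cauchy⇒coord-cauchy : ∀ {s} → Cauchy w s → ∀ i → Cauchy v (λ k → coord (s k) i)
  cauchy⇒coord-cauchy {s} cauchy i m = proj₁ small , λ {k} {l} p q →
      ≤ᵛpred⇒<ᵛ (V.≲-mono {coord (s k) i F.- coord (s l) i} (-∣i∣≤i (ℤ.pred m))
        (V.≲-cong {coord (s k - s l) i} (F.sym (coord-minus (s k) (s l) i))
          (proj₂ coord-≲ ℤ.∣ ℤ.pred m ∣
            (≲-mono {s k - s l} (ℤ.≤-reflexive (ℤ.pred-suc -r)) (<ᵛ⇒≤ᵛpred (proj₂ small p q))) i)))
    where
    -- The radius at which `coord-≲` gives the precision wanted for `m`; the successor taken next
    -- absorbs the strict inequality of `Cauchy`.
    -r = ℤ.- (+ (d ℕ.* (proj₁ coord-≲ ℕ.+ ℤ.∣ ℤ.pred m ∣)))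
    small = cauchy (ℤ.suc -r)

  coord-⟶ : ∀ {s x} → (∀ i → (λ k → coord (s k) i) V.⟶ x i) → s ⟶ lin x e
  coord-⟶ {s} {x} coord⟶ k = proj₁ small , λ {j} j≥ →
      ≲-cong {lin (λ i → coord (s j) i F.- x i) e}
        (≈-trans (lin-minus (coord (s j)) x e) (+-congʳ (lin-coord (s j))))
        (proj₂ lin-≲ k (λ i → coord (s j) i F.- x i) (proj₂ small j≥))
    where
    small = eventually-∀ {P = λ i j → coord (s j) i F.- x i V.≲ ℤ.- (+ (proj₁ lin-≲ ℕ.+ k))}
              (λ i → coord⟶ i (proj₁ lin-≲ ℕ.+ k))

  isComplete : IsComplete w
  isComplete s cauchy = lin x e , ⟶⇒ConvergesTo {s} {lin x e} (coord-⟶ {s} {x} λ i →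
      V.ConvergesTo⇒⟶ {λ k → coord (s k) i} {x i}
        (proj₂ (complete (λ k → coord (s k) i) (cauchy⇒coord-cauchy cauchy i))))
    where
    x : Vector F.Carrier n
    x i = proj₁ (complete (λ k → coord (s k) i) (cauchy⇒coord-cauchy cauchy i))

  module _ (digits : List F.Carrier) (digit : ∀ a → V.Integral a → Any (λ r → a F.- r V.≲ ℤ.-1ℤ) digits) where
    open FiniteResidues v π val-π digits digit

    private
      _∈𝔪+_ : Carrier → Carrier → Set
      x ∈𝔪+ y = x - y ≲ ℤ.-1ℤ

    -- Recombining coordinates loses `M` digits, so `M + 1` of them are needed for congruence modulo
    -- the maximal ideal.
    approximations : ∃[ ys ] ∀ {x} → Integral x → Any (x ∈𝔪+_) ys
    approximations with coord-bound | lin-≲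
    ... | N , coord≲N | M , lin-≲M =
      map (λ t → lin t e) (vectors (approximants N (M ℕ.+ 1)) n) , λ {x} int →
        Any.map⁺ (Any.map (λ {t} t≈ → ≲-cong
            (≈-trans (lin-minus (coord x) t e) (+-congʳ (lin-coord x))) (lin-≲M 1 _ t≈))
          (vectors⁺ λ i → approximant N (M ℕ.+ 1) (coord≲N int i)))

    integralElements : List Carrier → List (Σ Carrier Integral)
    integralElements []       = []
    integralElements (y ∷ ys) with ≤ᵛ-<ᵛ-connex (val y) 1ᵛ
    ... | inj₁ int = (y , int) ∷ integralElements ys
    ... | inj₂ _   = integralElements ys

    -- A combination of approximate coordinates may leave the unit ball and is then discarded. By
    -- the ultrametric inequality this never happens to one congruent to an integral element.
    integralElements⁺ : ∀ {x ys} → Integral x → Any (x ∈𝔪+_) ys →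
      Any (λ (y , _) → x ∈𝔪+ y) (integralElements ys)
    integralElements⁺ {x} {y ∷ ys} int x∈ with ≤ᵛ-<ᵛ-connex (val y) 1ᵛ | x∈
    ... | inj₁ _   | here p  = here p
    ... | inj₁ _   | there p = there (integralElements⁺ int p)
    ... | inj₂ 1<y | here p  = contradiction
      (≲-cong (solve 2 (λ x y → x :- (x :- y) := y) ≈-refl x y) (≲-minus int (≲-mono ℤ.-≤+ p))) (<ᵛ⇒≱ᵛ 1<y)
    ... | inj₂ _   | there p = integralElements⁺ int p

    hasFiniteResidueField : HasFiniteResidueField w
    hasFiniteResidueField with approximations
    ... | ys , approximate = integralElements ys , λ (x , int) →
      Any.map (λ {(y , int-y)} p → val<1⇒∈MaximalIdeal w
          (CommutativeRing._-_ (unitBall w) (x , int) (y , int-y)) (≤ᵛpred⇒<ᵛ p))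
        (integralElements⁺ int (approximate int))

-- Completions of ℚ

-- The search descends from its bound; the powers of `p` with exponent at least 2 exceed `p` and
-- cannot divide it, so it stops at 1.
exponentUpTo-self : ∀ {p} → 2 ℕ.≤ p → ∀ b → exponentUpTo p p (suc b) ≡ 1
exponentUpTo-self {p} 2≤p zero with p ℕ.^ 1 ∣? p
... | yes _  = refl
... | no p∤p = contradiction (∣-reflexive (ℕ.*-identityʳ p)) p∤p
exponentUpTo-self {p} 2≤p (suc b) with p ℕ.^ suc (suc b) ∣? p
... | no _       = exponentUpTo-self 2≤p b
... | yes p^b∣p = contradiction p^b∣p (>⇒∤ {{ℕ.>-nonZero (ℕ.<-trans ℕ.z<s 2≤p)}}
        (subst (ℕ._< p ℕ.^ suc (suc b)) (ℕ.*-identityʳ p) (ℕ.^-monoʳ-< p 2≤p {1} {suc (suc b)} (ℕ.s≤s (ℕ.s≤s ℕ.z≤n)))))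

exponentUpTo-1 : ∀ {p} → 2 ℕ.≤ p → exponentUpTo p 1 1 ≡ 0
exponentUpTo-1 {p} 2≤p with p ℕ.^ 1 ∣? 1
... | no _     = refl
... | yes p∣1 = contradiction p∣1 (>⇒∤ (subst (2 ℕ.≤_) (sym (ℕ.*-identityʳ p)) 2≤p))

∤⇒coprime : ∀ {p n} → Prime p → p ∤ n → Coprime p n
∤⇒coprime pr p∤n (d∣p , d∣n) with prime⇒irreducible pr d∣p
... | inj₁ d≡1  = d≡1
... | inj₂ refl = contradiction d∣n p∤n

-- Written with explicit denominator 1, so that `padicVal` computes on it.
ℕ→ℚ : ℕ → ℚ
ℕ→ℚ n = mkℚ (+ n) 0 (Coprimality.sym (Coprimality.1-coprimeTo n))

ℕ→ℚ-suc : ∀ n → ℕ→ℚ (suc n) ≡ ℚ.1ℚ ℚ.+ ℕ→ℚ n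
ℕ→ℚ-suc n = ℚ.toℚᵘ-injective (ℚᵘ.≃-trans (*≡* (numerators n))
  (ℚᵘ.≃-sym (ℚ.toℚᵘ-homo-+ ℚ.1ℚ (ℕ→ℚ n))))
  where
  numerators : ∀ n → + suc n ℤ.* + 1 ≡ (+ 1 ℤ.* + 1 ℤ.+ + n ℤ.* + 1) ℤ.* + 1
  numerators n = cong (ℤ._* + 1) (cong (λ t → + 1 ℤ.+ t) (sym (ℤ.*-identityʳ (+ n))))

mkℚ-*-denominator : ∀ z s .(cop : Coprime ℤ.∣ z ∣ (suc s)) → mkℚ z s cop ℚ.* ℕ→ℚ (suc s) ≡ mkℚ z 0 (Coprimality.sym (Coprimality.1-coprimeTo ℤ.∣ z ∣))
mkℚ-*-denominator z s cop = ℚ.toℚᵘ-injective (ℚᵘ.≃-trans (ℚ.toℚᵘ-homo-* (mkℚ z s cop) (ℕ→ℚ (suc s)))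
  (*≡* (trans (ℤ.*-identityʳ (z ℤ.* + suc s)) (cong (λ t → z ℤ.* + suc t) (sym (ℕ.*-identityʳ s))))))

module CompletionOfℚ {p : ℕ} (pr : Prime p) {F : Field c ℓ₁ ℓ₂} (v : Valuation F)
                     (completion : IsCompletion ℚ-field (padicVal p) F v) where
  open Field F hiding (zero) renaming (refl to ≈-refl; sym to ≈-sym; trans to ≈-trans)
  open FieldProperties F
  open ValuationProperties v
  open IsCompletion completion
  open RingMorphisms.IsRingHomomorphism isEmbedding
    using () renaming (+-homo to ι-+; *-homo to ι-*; -‿homo to ι-neg; 0#-homo to ι-0; 1#-homo to ι-1)
  open SemiringMult semiring using (×1-homo-*)
  open SetoidReasoning setoid

  private
    2≤p : 2 ℕ.≤ p
    2≤p = ℕ.nonTrivial⇒n>1 p {{prime⇒nonTrivial pr}}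

  ι-ℕ : ∀ n → ι (ℕ→ℚ n) ≈ n · 1#
  ι-ℕ zero    = ι-0
  ι-ℕ (suc n) = begin
    ι (ℕ→ℚ (suc n))          ≡⟨ cong ι (ℕ→ℚ-suc n) ⟩
    ι (ℚ.1ℚ ℚ.+ ℕ→ℚ n)       ≈⟨ ι-+ ℚ.1ℚ (ℕ→ℚ n) ⟩
    ι ℚ.1ℚ + ι (ℕ→ℚ n)       ≈⟨ +-cong ι-1 (ι-ℕ n) ⟩
    1# + n · 1#              ∎

  ι-ℤ : ∀ z → ι (mkℚ z 0 (Coprimality.sym (Coprimality.1-coprimeTo ℤ.∣ z ∣))) ≈ fromℤ z
  ι-ℤ (+ n)      = ι-ℕ n
  ι-ℤ ℤ.-[1+ n ] = ≈-trans (ι-neg (ℕ→ℚ (suc n))) (-‿cong (ι-ℕ (suc n)))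

  char-0 : ∀ n → ¬ (suc n · 1# ≈ 0#)
  char-0 n e with trans (sym (extends (ℕ→ℚ (suc n)))) (trans (val-cong (≈-trans (ι-ℕ (suc n)) e)) val-0)
  ... | ()

  val-p : val (p · 1#) ≡ [ ℤ.-1ℤ ]
  val-p = trans (val-cong (≈-sym (ι-ℕ p))) (trans (extends (ℕ→ℚ p)) (padicVal-p 2≤p))
    where
    padicVal-p : ∀ {p} → 2 ℕ.≤ p → padicVal p (ℕ→ℚ p) ≡ [ ℤ.-1ℤ ]
    padicVal-p {suc p} 2≤p = cong₂ (λ i j → [ ℤ.- (+ i ℤ.- + j) ]) (exponentUpTo-self 2≤p p) (exponentUpTo-1 2≤p)

  p≲ : p · 1# ≲ ℤ.-1ℤ
  p≲ = ≤ᵛ-reflexive val-p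

  multiple-of-p : ∀ {x} → Integral x → x * (p · 1#) ≲ ℤ.-1ℤ
  multiple-of-p int = ≲-scale int p≲

  fromℤ-integral : ∀ z → Integral (fromℤ z)
  fromℤ-integral (+ n)      = integral-· n
  fromℤ-integral ℤ.-[1+ n ] = ≲-neg (integral-· (suc n))

  inverse-mod-p : ∀ {n} → p ∤ n → ∃[ u ] 1# - fromℤ u * (n · 1#) ≲ ℤ.-1ℤ
  inverse-mod-p {n} p∤n with coprime-Bézout (∤⇒coprime pr p∤n)
  -- Bézout identities over the naturals come in two sign patterns; in this one the inverse of `n`
  -- modulo `p` is minus `y`.
  ... | Bézout.+- x y 1+yn≡xp = ℤ.- (+ y) , ≲-cong (begin
      (x · 1#) * (p · 1#)              ≈⟨ ×1-homo-* x p ⟨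
      (x ℕ.* p) · 1#                   ≡⟨ cong (_· 1#) 1+yn≡xp ⟨
      1# + (y ℕ.* n) · 1#              ≈⟨ +-congˡ (×1-homo-* y n) ⟩
      1# + (y · 1#) * (n · 1#)         ≈⟨ solve 3 (λ o y n → o :+ y :* n := o :- (:- y) :* n) ≈-refl 1# (y · 1#) (n · 1#) ⟩
      1# - (- (y · 1#)) * (n · 1#)     ≈⟨ +-congˡ (-‿cong (*-congʳ (fromℤ-neg (+ y)))) ⟨
      1# - fromℤ (ℤ.- (+ y)) * (n · 1#) ∎) (multiple-of-p (integral-· x))
  ... | Bézout.-+ x y 1+xp≡yn = + y , ≲-cong (begin
      - ((x · 1#) * (p · 1#))          ≈⟨ solve 2 (λ o s → :- s := o :- (o :+ s)) ≈-refl 1# _ ⟩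
      1# - (1# + (x · 1#) * (p · 1#))  ≈⟨ +-congˡ (-‿cong (+-congˡ (×1-homo-* x p))) ⟨
      1# - (1# + (x ℕ.* p) · 1#)       ≡⟨ cong (λ m → 1# - m · 1#) 1+xp≡yn ⟩
      1# - (y ℕ.* n) · 1#              ≈⟨ +-congˡ (-‿cong (×1-homo-* y n)) ⟩
      1# - (y · 1#) * (n · 1#)         ∎) (≲-neg (multiple-of-p (integral-· x)))

  digits : List Carrier
  digits = map (_· 1#) (upTo p)

  integer-digit : ∀ z → Any (λ d → fromℤ z - d ≲ ℤ.-1ℤ) digits
  integer-digit z = Any.map⁺ (Any.map (λ {refl → ≲-cong (begin
      fromℤ (z ℤ./ℕ p) * (p · 1#)
        ≈⟨ solve 2 (λ r q → q := (r :+ q) :- r) ≈-refl ((z ℤ.%ℕ p) · 1#) (fromℤ (z ℤ./ℕ p) * (p · 1#)) ⟩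
      ((z ℤ.%ℕ p) · 1# + fromℤ (z ℤ./ℕ p) * fromℤ (+ p)) - (z ℤ.%ℕ p) · 1#
        ≈⟨ +-congʳ (≈-trans (fromℤ-+ (+ (z ℤ.%ℕ p)) (z ℤ./ℕ p ℤ.* + p)) (+-congˡ (fromℤ-* (z ℤ./ℕ p) (+ p)))) ⟨
      fromℤ (+ (z ℤ.%ℕ p) ℤ.+ z ℤ./ℕ p ℤ.* + p) - (z ℤ.%ℕ p) · 1#
        ≡⟨ cong (λ i → fromℤ i - (z ℤ.%ℕ p) · 1#) (ℤ.a≡a%ℕn+[a/ℕn]*n z p) ⟨
      fromℤ z - (z ℤ.%ℕ p) · 1# ∎) (multiple-of-p (fromℤ-integral (z ℤ./ℕ p)))})
    (List.∈-upTo⁺ (ℤ.n%ℕd<d z p)))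
    where instance _ = prime⇒nonZero pr

  -- Density replaces `x` by a fraction with numerator `z` in the same residue class. Its
  -- denominator is prime to `p`, hence has an inverse `u` modulo `p`, and the fraction is congruent
  -- to the integer `u ℤ.* z`, which has a remainder modulo `p`.
  digit : ∀ x → Integral x → Any (λ d → x - d ≲ ℤ.-1ℤ) digits
  digit x int with dense x 0ℤ
  ... | mkℚ z s cop , x-r<1 = Any.map (λ {d} → ≲-triangle _ x-uz) (integer-digit (u ℤ.* z))
    where
    r = ι (mkℚ z s cop)
    x-r : x - r ≲ ℤ.-1ℤ
    x-r = <ᵛ⇒≤ᵛpred x-r<1
    r-integral : Integral r
    r-integral = ≲-cong (solve 2 (λ x r → x :- (x :- r) := r) ≈-refl x r) (≲-minus int (≲-mono ℤ.-≤+ x-r))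
    S = suc s · 1#
    r*S≈z : r * S ≈ fromℤ z
    r*S≈z = begin
      r * S                                   ≈⟨ *-congˡ (ι-ℕ (suc s)) ⟨
      r * ι (ℕ→ℚ (suc s))                     ≈⟨ ι-* (mkℚ z s cop) (ℕ→ℚ (suc s)) ⟨
      ι (mkℚ z s cop ℚ.* ℕ→ℚ (suc s))         ≡⟨ cong ι (mkℚ-*-denominator z s cop) ⟩
      ι (mkℚ z 0 _)                           ≈⟨ ι-ℤ z ⟩
      fromℤ z                                 ∎
    -- Otherwise `z` would be prime to `p` by reducedness, yet of value below 1 because `r` is
    -- integral and `r * S` is `z`; inverting `z` modulo `p` would then put `1#` in the maximal
    -- ideal.
    p∤S : p ∤ suc s
    p∤S p∣S@(divides q S≡qp) with inverse-mod-p p∤z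
      where
      p∤z : p ∤ ℤ.∣ z ∣
      p∤z p∣z = ℕ.<⇒≢ 2≤p (sym (Coprimality.recompute cop (p∣z , p∣S)))
    ... | u , 1-uz = ⊥-elim (absurd (≲-cong (solve 2 (λ o t → (o :- t) :+ t := o) ≈-refl 1# _)
                       (≲-+ 1-uz (≲-scale (fromℤ-integral u) ∣z∣≲))))
      where
      absurd : ¬ (1# ≲ ℤ.-1ℤ)
      absurd 1≲ with subst (_≤ᵛ [ ℤ.-1ℤ ]) val-1 1≲
      ... | [ () ]
      z≲ : fromℤ z ≲ ℤ.-1ℤ
      z≲ = ≲-cong r*S≈z (≲-scale r-integral (≲-cong
        (≈-trans (≈-sym (×1-homo-* q p)) (reflexive (cong (_· 1#) (sym S≡qp)))) (multiple-of-p (integral-· q))))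
      abs : ∀ z → fromℤ z ≲ ℤ.-1ℤ → ℤ.∣ z ∣ · 1# ≲ ℤ.-1ℤ
      abs (+ n)      h = h
      abs ℤ.-[1+ n ] h = ≲-cong (-‿involutive _) (≲-neg h)
      ∣z∣≲ : ℤ.∣ z ∣ · 1# ≲ ℤ.-1ℤ
      ∣z∣≲ = abs z z≲
    u = proj₁ (inverse-mod-p p∤S)
    x-uz : x - fromℤ (u ℤ.* z) ≲ ℤ.-1ℤ
    x-uz = ≲-triangle r x-r (≲-cong (begin
      r * (1# - fromℤ u * S)          ≈⟨ solve 4 (λ r o u s → r :* (o :- u :* s) := r :* o :- u :* (r :* s)) ≈-refl r 1# (fromℤ u) S ⟩
      r * 1# - fromℤ u * (r * S)      ≈⟨ +-cong (*-identityʳ r) (-‿cong (*-congˡ r*S≈z)) ⟩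
      r - fromℤ u * fromℤ z           ≈⟨ +-congˡ (-‿cong (fromℤ-* u z)) ⟨
      r - fromℤ (u ℤ.* z)             ∎) (≲-scale r-integral (proj₂ (inverse-mod-p p∤S))))

mainTheorem8 : ∀ {c ℓ₁ ℓ₂ c′ ℓ₁′ ℓ₂′ : Level} (p : ℕ) → Prime p →
    (ℚₚ : Field c ℓ₁ ℓ₂) (vₚ : Valuation ℚₚ) → IsCompletion ℚ-field (padicVal p) ℚₚ vₚ →
    (K : Field c′ ℓ₁′ ℓ₂′) (K/ℚₚ : FiniteExtension ℚₚ K) →
    (w : Valuation K) → Valuation.IsDiscrete w → Extends K/ℚₚ vₚ w →
    IsLocalField K w
mainTheorem8 p pr ℚₚ vₚ completion K K/ℚₚ w isDiscrete extends = record
  { isDiscrete         = isDiscrete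
  ; isComplete         = E.isComplete
  ; finiteResidueField = E.hasFiniteResidueField C.digits C.digit
  }
  where
  module C = CompletionOfℚ pr vₚ completion
  -- The uniformizer left to inference is the image of `p`, read off from `C.val-p`.
  module E = LocalFieldExtension K/ℚₚ vₚ (IsCompletion.complete completion) _ C.val-p w extends C.char-0
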